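{- Let $(P_n(x))_{n\ge0}$ be a sequence of polynomials such that $\sum_{n\ge0}P_n(x)\frac{t^n}{n!}=f(t)e^{xt}$ for some $f$ holomorphic at $0$ with $f(0)\neq0$, and such that $P_n(1-x)=(-1)^nP_n(x)$ for all $n\ge0$. Let $N$ be a positive integer. If the function $F(t)=f(t)-\sum_{k=0}^{N}B_k(0)\frac{t^k}{k!}$ is even, then $P_n(x)=B_n(x)$ for all $n\ge0$ and $f(t)=\frac{t}{e^t-1}$.
   Context: $B_n(x)$ denotes the Bernoulli polynomials, defined by $\sum_{n\ge0}B_n(x)\frac{t^n}{n!}=\frac{te^{xt}}{e^t-1}$; $B_k(0)$ are the Bernoulli numbers. -}

module Defs where

open import Data.Nat.Base as ℕ using (ℕ; zero; suc; _!)
import Data.Nat.Properties as ℕ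
open import Data.Integer.Base as ℤ using (+_; -[1+_])
import Data.Integer.Properties as ℤ
open import Data.List.Base using (List; foldr)
open import Data.Product.Base using (∃-syntax; _×_; _,_; proj₁; proj₂)
open import Data.Rational.Base as ℚ using (ℚ; mkℚ; 0ℚ; 1ℚ; ½; _/_; ∣_∣; Positive; NonZero)
import Data.Rational.Properties as ℚ
open import Data.Rational.Solver using (module +-*-Solver)
open import Data.Rational.Unnormalised.Base as ℚᵘ using (mkℚᵘ; *<*; *≡*)
import Data.Rational.Unnormalised.Properties as ℚᵘ
open import Data.Sum.Base using (inj₁; inj₂)
open import Relation.Binary.PropositionalEquality
  using (_≡_; refl; sym; trans; cong; cong₂; subst)

IsCauchy : (ℕ → ℚ) → Set
IsCauchy s = ∀ ε → 0ℚ ℚ.< ε →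
  ∃[ N ] (∀ m n → N ℕ.≤ m → N ℕ.≤ n → ∣ s m ℚ.- s n ∣ ℚ.< ε)

1/_! : ℕ → ℚ
1/ n ! = (+ 1 / n !) {{n ℕ.!≢0}}

abstract

  half>0 : ∀ {ε} → 0ℚ ℚ.< ε → 0ℚ ℚ.< ε ℚ.* ½
  half>0 {ε} ε>0 = subst (ℚ._< ε ℚ.* ½) (ℚ.*-zeroˡ ½) (ℚ.*-monoˡ-<-pos ½ ε>0)

  half+half : ∀ ε → ε ℚ.* ½ ℚ.+ ε ℚ.* ½ ≡ ε
  half+half = solve 1 (λ e → e :* con ½ :+ e :* con ½ := e) refl
    where open +-*-Solver

  *>0 : ∀ {p q} → 0ℚ ℚ.< p → 0ℚ ℚ.< q → 0ℚ ℚ.< p ℚ.* q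
  *>0 {p} {q} p>0 q>0 =
    subst (ℚ._< p ℚ.* q) (ℚ.*-zeroˡ q) (ℚ.*-monoˡ-<-pos q {{ℚ.positive q>0}} p>0)

  *-mono-≤₀ : ∀ {p q r s} → 0ℚ ℚ.≤ r → 0ℚ ℚ.≤ q → p ℚ.≤ q → r ℚ.≤ s →
              p ℚ.* r ℚ.≤ q ℚ.* s
  *-mono-≤₀ {p} {q} {r} {s} r≥0 q≥0 p≤q r≤s = ℚ.≤-trans
    (ℚ.*-monoʳ-≤-nonNeg r {{ℚ.nonNegative r≥0}} p≤q)
    (ℚ.*-monoˡ-≤-nonNeg q {{ℚ.nonNegative q≥0}} r≤s)

  divide : ∀ ε B → 0ℚ ℚ.< ε → 0ℚ ℚ.< B → ∃[ δ ] (0ℚ ℚ.< δ × δ ℚ.* B ≡ ε)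
  divide ε B ε>0 B>0 =
    ε ℚ.* B⁻¹ , *>0 ε>0 (ℚ.positive⁻¹ B⁻¹ {{ℚ.1/pos⇒pos B}}) ,
    trans (ℚ.*-assoc ε B⁻¹ B)
      (trans (cong (ε ℚ.*_) (ℚ.*-inverseˡ B)) (ℚ.*-identityʳ ε))
    where
    instance
      posB : Positive B
      posB = ℚ.positive B>0
      nzB : NonZero B
      nzB = ℚ.pos⇒nonZero B
    B⁻¹ : ℚ
    B⁻¹ = ℚ.1/ B

  triangle : ∀ a b c → ∣ a ℚ.- c ∣ ℚ.≤ ∣ a ℚ.- b ∣ ℚ.+ ∣ b ℚ.- c ∣
  triangle a b c = subst (λ x → ∣ x ∣ ℚ.≤ ∣ a ℚ.- b ∣ ℚ.+ ∣ b ℚ.- c ∣)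
    (solve 3 (λ x y z → (x :- y) :+ (y :- z) := x :- z) refl a b c)
    (ℚ.∣p+q∣≤∣p∣+∣q∣ (a ℚ.- b) (b ℚ.- c))
    where open +-*-Solver

  ∣-∣-sym : ∀ a b → ∣ a ℚ.- b ∣ ≡ ∣ b ℚ.- a ∣
  ∣-∣-sym a b = trans (sym (ℚ.∣-p∣≡∣p∣ (a ℚ.- b)))
    (cong ∣_∣ (solve 2 (λ x y → :- (x :- y) := y :- x) refl a b))
    where open +-*-Solver

  toℚᵘ-/1 : ∀ L → ℚ.toℚᵘ (+ L / 1) ℚᵘ.≃ mkℚᵘ (+ L) 0
  toℚᵘ-/1 L = ℚ.toℚᵘ-fromℚᵘ (mkℚᵘ (+ L) 0)

  archimedean : ∀ p → ∃[ L ] p ℚ.< + L / 1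
  archimedean (mkℚ (+ n) d c) = suc n , ℚ.toℚᵘ-cancel-< (ℚᵘ.<-respʳ-≃
    (ℚᵘ.≃-sym (toℚᵘ-/1 (suc n))) (*<* (subst (ℤ._< + (suc n ℕ.* suc d))
      (sym (ℤ.*-identityʳ (+ n))) (ℤ.+<+ (ℕ.m≤m*n (suc n) (suc d))))))
  archimedean (mkℚ -[1+ n ] d c) = 0 , ℚ.toℚᵘ-cancel-< (ℚᵘ.<-respʳ-≃
    (ℚᵘ.≃-sym (toℚᵘ-/1 0)) (*<* ℤ.-<+))

  /1-mono : ∀ {m n} → m ℕ.≤ n → + m / 1 ℚ.≤ + n / 1
  /1-mono {m} {n} m≤n = ℚ.toℚᵘ-cancel-≤
    (ℚᵘ.≤-respˡ-≃ (ℚᵘ.≃-sym (toℚᵘ-/1 m)) (ℚᵘ.≤-respʳ-≃ (ℚᵘ.≃-sym (toℚᵘ-/1 n))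
      (ℚᵘ.*≤* (ℤ.*-monoʳ-≤-nonNeg (+ 1) (ℤ.+≤+ m≤n)))))

  /1-suc : ∀ n → + suc n / 1 ≡ + n / 1 ℚ.+ 1ℚ
  /1-suc n = ℚ.toℚᵘ-injective (ℚᵘ.≃-trans (toℚᵘ-/1 (suc n)) (ℚᵘ.≃-trans
    (*≡* (cong (ℤ._* + 1) (trans (cong +_ (ℕ.+-comm 1 n))
      (cong (ℤ._+ + 1) (sym (ℤ.*-identityʳ (+ n)))))))
    (ℚᵘ.≃-sym (ℚᵘ.≃-trans (ℚ.toℚᵘ-homo-+ (+ n / 1) 1ℚ)
      (ℚᵘ.+-congˡ (ℚ.toℚᵘ 1ℚ) (toℚᵘ-/1 n))))))

  1/-* : ∀ a b .{{_ : ℕ.NonZero a}} .{{_ : ℕ.NonZero b}} .{{_ : ℕ.NonZero (a ℕ.* b)}} →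
         + 1 / (a ℕ.* b) ≡ (+ 1 / a) ℚ.* (+ 1 / b)
  1/-* (suc a) (suc b) = ℚ.toℚᵘ-injective (ℚᵘ.≃-trans
    (ℚ.toℚᵘ-fromℚᵘ (mkℚᵘ (+ 1) (b ℕ.+ a ℕ.* suc b)))
    (ℚᵘ.≃-sym (ℚᵘ.≃-trans (ℚ.toℚᵘ-homo-* (+ 1 / suc a) (+ 1 / suc b))
      (ℚᵘ.*-cong (ℚ.toℚᵘ-fromℚᵘ (mkℚᵘ (+ 1) a)) (ℚ.toℚᵘ-fromℚᵘ (mkℚᵘ (+ 1) b))))))

  /1-*-inverse : ∀ n → (+ suc n / 1) ℚ.* (+ 1 / suc n) ≡ 1ℚ
  /1-*-inverse n = ℚ.toℚᵘ-injective (ℚᵘ.≃-trans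
    (ℚ.toℚᵘ-homo-* (+ suc n / 1) (+ 1 / suc n))
    (ℚᵘ.≃-trans
      (ℚᵘ.*-cong (toℚᵘ-/1 (suc n)) (ℚ.toℚᵘ-fromℚᵘ (mkℚᵘ (+ 1) n)))
      (*≡* (cong +_ (trans (ℕ.*-identityʳ (suc n ℕ.* 1))
         (trans (ℕ.*-identityʳ (suc n)) (sym (trans (ℕ.*-identityˡ (1 ℕ.* suc n))
           (ℕ.*-identityˡ (suc n))))))))))

  1/>0 : ∀ n .{{_ : ℕ.NonZero n}} → 0ℚ ℚ.< + 1 / n
  1/>0 (suc n) = ℚ.toℚᵘ-cancel-< (ℚᵘ.<-respʳ-≃
    (ℚᵘ.≃-sym (ℚ.toℚᵘ-fromℚᵘ (mkℚᵘ (+ 1) n))) (ℚᵘ.positive⁻¹ (mkℚᵘ (+ 1) n)))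

  const-cauchy : ∀ p → IsCauchy (λ _ → p)
  const-cauchy p ε ε>0 =
    0 , λ _ _ _ _ → subst (ℚ._< ε) (sym (cong ∣_∣ (ℚ.+-inverseʳ p))) ε>0

  +-cauchy : ∀ s t → IsCauchy s → IsCauchy t → IsCauchy (λ n → s n ℚ.+ t n)
  +-cauchy s t cs ct ε ε>0 with cs (ε ℚ.* ½) (half>0 ε>0) | ct (ε ℚ.* ½) (half>0 ε>0)
  ... | N₁ , h₁ | N₂ , h₂ = N₁ ℕ.⊔ N₂ , λ m n p q → begin-strict
      ∣ (s m ℚ.+ t m) ℚ.- (s n ℚ.+ t n) ∣
        ≡⟨ cong ∣_∣ (solve 4 (λ a b c d → (a :+ b) :- (c :+ d) := (a :- c) :+ (b :- d))
             refl (s m) (t m) (s n) (t n)) ⟩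
      ∣ (s m ℚ.- s n) ℚ.+ (t m ℚ.- t n) ∣
        ≤⟨ ℚ.∣p+q∣≤∣p∣+∣q∣ (s m ℚ.- s n) (t m ℚ.- t n) ⟩
      ∣ s m ℚ.- s n ∣ ℚ.+ ∣ t m ℚ.- t n ∣
        <⟨ ℚ.+-mono-< (h₁ m n (ℕ.m⊔n≤o⇒m≤o N₁ N₂ p) (ℕ.m⊔n≤o⇒m≤o N₁ N₂ q))
                      (h₂ m n (ℕ.m⊔n≤o⇒n≤o N₁ N₂ p) (ℕ.m⊔n≤o⇒n≤o N₁ N₂ q)) ⟩
      ε ℚ.* ½ ℚ.+ ε ℚ.* ½ ≡⟨ half+half ε ⟩
      ε ∎
    where
    open ℚ.≤-Reasoning
    open +-*-Solver

  neg-cauchy : ∀ s → IsCauchy s → IsCauchy (λ n → ℚ.- s n)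
  neg-cauchy s cs ε ε>0 with cs ε ε>0
  ... | N , h = N , λ m n p q → subst (ℚ._< ε)
        (trans (sym (ℚ.∣-p∣≡∣p∣ (s m ℚ.- s n))) (cong ∣_∣ (ℚ.neg-distrib-+ (s m) (ℚ.- s n))))
        (h m n p q)

  prefixBound : ∀ (s : ℕ → ℚ) N → ∃[ B ] (0ℚ ℚ.≤ B × (∀ n → n ℕ.< N → ∣ s n ∣ ℚ.≤ B))
  prefixBound s zero = 0ℚ , ℚ.≤-refl , λ _ ()
  prefixBound s (suc N) with prefixBound s N
  ... | B , B≥0 , h = B ℚ.+ ∣ s N ∣ , ℚ.+-mono-≤ B≥0 (ℚ.0≤∣p∣ (s N)) , bound
    where
    bound : ∀ n → n ℕ.< suc N → ∣ s n ∣ ℚ.≤ B ℚ.+ ∣ s N ∣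
    bound n n<1+N with ℕ.m≤n⇒m<n∨m≡n (ℕ.s≤s⁻¹ n<1+N)
    ... | inj₁ n<N  = subst (ℚ._≤ B ℚ.+ ∣ s N ∣) (ℚ.+-identityʳ ∣ s n ∣)
                        (ℚ.+-mono-≤ (h n n<N) (ℚ.0≤∣p∣ (s N)))
    ... | inj₂ refl = subst (ℚ._≤ B ℚ.+ ∣ s N ∣) (ℚ.+-identityˡ ∣ s N ∣)
                        (ℚ.+-monoˡ-≤ ∣ s N ∣ B≥0)

  cauchy⇒bounded : ∀ s → IsCauchy s → ∃[ B ] (0ℚ ℚ.< B × (∀ n → ∣ s n ∣ ℚ.≤ B))
  cauchy⇒bounded s cs with cs 1ℚ (ℚ.positive⁻¹ 1ℚ)
  ... | N , h with prefixBound s N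
  ...   | B , B≥0 , hB = B′ , B′>0 , bound
    where
    open ℚ.≤-Reasoning
    C : ℚ
    C = 1ℚ ℚ.+ ∣ s N ∣
    C>0 : 0ℚ ℚ.< C
    C>0 = ℚ.+-mono-<-≤ (ℚ.positive⁻¹ 1ℚ) (ℚ.0≤∣p∣ (s N))
    B′ : ℚ
    B′ = B ℚ.+ C
    B′>0 : 0ℚ ℚ.< B′
    B′>0 = ℚ.+-mono-≤-< B≥0 C>0
    bound : ∀ n → ∣ s n ∣ ℚ.≤ B′
    bound n with ℕ.<-≤-connex n N
    ... | inj₁ n<N = begin
      ∣ s n ∣          ≤⟨ hB n n<N ⟩
      B                ≡⟨ ℚ.+-identityʳ B ⟨
      B ℚ.+ 0ℚ         ≤⟨ ℚ.+-monoʳ-≤ B (ℚ.<⇒≤ C>0) ⟩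
      B′               ∎
    ... | inj₂ N≤n = begin
      ∣ s n ∣
        ≡⟨ cong ∣_∣ (solve 2 (λ a b → a := (a :- b) :+ b) refl (s n) (s N)) ⟩
      ∣ (s n ℚ.- s N) ℚ.+ s N ∣     ≤⟨ ℚ.∣p+q∣≤∣p∣+∣q∣ (s n ℚ.- s N) (s N) ⟩
      ∣ s n ℚ.- s N ∣ ℚ.+ ∣ s N ∣   ≤⟨ ℚ.+-monoˡ-≤ ∣ s N ∣ (ℚ.<⇒≤ (h n N N≤n ℕ.≤-refl)) ⟩
      C                             ≡⟨ ℚ.+-identityˡ C ⟨
      0ℚ ℚ.+ C                      ≤⟨ ℚ.+-monoˡ-≤ C B≥0 ⟩
      B′                            ∎
      where open +-*-Solver

  *-cauchy : ∀ s t → IsCauchy s → IsCauchy t → IsCauchy (λ n → s n ℚ.* t n)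
  *-cauchy s t cs ct ε ε>0 with cauchy⇒bounded s cs | cauchy⇒bounded t ct
  ... | A , A>0 , hA | B , B>0 , hB
      with divide (ε ℚ.* ½) B (half>0 ε>0) B>0 | divide (ε ℚ.* ½) A (half>0 ε>0) A>0
  ...   | δ₁ , δ₁>0 , e₁ | δ₂ , δ₂>0 , e₂ with cs δ₁ δ₁>0 | ct δ₂ δ₂>0
  ...     | N₁ , h₁ | N₂ , h₂ = N₁ ℕ.⊔ N₂ , close
    where
    open ℚ.≤-Reasoning
    open +-*-Solver
    close : ∀ m n → N₁ ℕ.⊔ N₂ ℕ.≤ m → N₁ ℕ.⊔ N₂ ℕ.≤ n →
            ∣ s m ℚ.* t m ℚ.- s n ℚ.* t n ∣ ℚ.< ε
    close m n p q = begin-strict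
      ∣ s m ℚ.* t m ℚ.- s n ℚ.* t n ∣
        ≡⟨ cong ∣_∣ (solve 4 (λ a b c d → a :* b :- c :* d := (a :- c) :* b :+ (b :- d) :* c)
             refl (s m) (t m) (s n) (t n)) ⟩
      ∣ (s m ℚ.- s n) ℚ.* t m ℚ.+ (t m ℚ.- t n) ℚ.* s n ∣
        ≤⟨ ℚ.∣p+q∣≤∣p∣+∣q∣ ((s m ℚ.- s n) ℚ.* t m) ((t m ℚ.- t n) ℚ.* s n) ⟩
      ∣ (s m ℚ.- s n) ℚ.* t m ∣ ℚ.+ ∣ (t m ℚ.- t n) ℚ.* s n ∣
        ≡⟨ cong₂ ℚ._+_ (ℚ.∣p*q∣≡∣p∣*∣q∣ (s m ℚ.- s n) (t m)) (ℚ.∣p*q∣≡∣p∣*∣q∣ (t m ℚ.- t n) (s n)) ⟩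
      ∣ s m ℚ.- s n ∣ ℚ.* ∣ t m ∣ ℚ.+ ∣ t m ℚ.- t n ∣ ℚ.* ∣ s n ∣
        ≤⟨ ℚ.+-mono-≤
             (ℚ.*-monoˡ-≤-nonNeg ∣ s m ℚ.- s n ∣ {{ℚ.∣-∣-nonNeg (s m ℚ.- s n)}} (hB m))
             (ℚ.*-monoˡ-≤-nonNeg ∣ t m ℚ.- t n ∣ {{ℚ.∣-∣-nonNeg (t m ℚ.- t n)}} (hA n)) ⟩
      ∣ s m ℚ.- s n ∣ ℚ.* B ℚ.+ ∣ t m ℚ.- t n ∣ ℚ.* A
        <⟨ ℚ.+-mono-<
             (ℚ.*-monoˡ-<-pos B {{ℚ.positive B>0}}
               (h₁ m n (ℕ.m⊔n≤o⇒m≤o N₁ N₂ p) (ℕ.m⊔n≤o⇒m≤o N₁ N₂ q)))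
             (ℚ.*-monoˡ-<-pos A {{ℚ.positive A>0}}
               (h₂ m n (ℕ.m⊔n≤o⇒n≤o N₁ N₂ p) (ℕ.m⊔n≤o⇒n≤o N₁ N₂ q))) ⟩
      δ₁ ℚ.* B ℚ.+ δ₂ ℚ.* A ≡⟨ cong₂ ℚ._+_ e₁ e₂ ⟩
      ε ℚ.* ½ ℚ.+ ε ℚ.* ½   ≡⟨ half+half ε ⟩
      ε ∎

-- Cauchy reals: equality is _≈ᴿ_, and the operations act termwise.
record ℝ : Set where
  constructor mkℝ
  field
    seq    : ℕ → ℚ
    cauchy : IsCauchy seq

open ℝ public

infix  4 _≈ᴿ_ _<ᴿ_ _≤ᴿ_
infixl 6 _+ᴿ_
infixl 7 _*ᴿ_
infix  8 -ᴿ_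

_≈ᴿ_ : ℝ → ℝ → Set
x ≈ᴿ y = ∀ ε → 0ℚ ℚ.< ε → ∃[ N ] (∀ n → N ℕ.≤ n → ∣ seq x n ℚ.- seq y n ∣ ℚ.< ε)

_<ᴿ_ : ℝ → ℝ → Set
x <ᴿ y = ∃[ ε ] (0ℚ ℚ.< ε × ∃[ N ] (∀ n → N ℕ.≤ n → seq x n ℚ.+ ε ℚ.< seq y n))

_≤ᴿ_ : ℝ → ℝ → Set
x ≤ᴿ y = ∀ ε → 0ℚ ℚ.< ε → ∃[ N ] (∀ n → N ℕ.≤ n → seq x n ℚ.< seq y n ℚ.+ ε)

fromℚᴿ : ℚ → ℝ
fromℚᴿ p = mkℝ (λ _ → p) (const-cauchy p)

_+ᴿ_ : ℝ → ℝ → ℝ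
x +ᴿ y = mkℝ (λ n → seq x n ℚ.+ seq y n) (+-cauchy (seq x) (seq y) (cauchy x) (cauchy y))

-ᴿ_ : ℝ → ℝ
-ᴿ x = mkℝ (λ n → ℚ.- seq x n) (neg-cauchy (seq x) (cauchy x))

_*ᴿ_ : ℝ → ℝ → ℝ
x *ᴿ y = mkℝ (λ n → seq x n ℚ.* seq y n) (*-cauchy (seq x) (seq y) (cauchy x) (cauchy y))

record ℂ : Set where
  constructor _+i_
  field
    re im : ℝ

open ℂ public

infix  4 _≈_ _#_
infixl 6 _+_ _-_
infixl 7 _*_
infix  8 -_
infixr 9 _^_

_≈_ : ℂ → ℂ → Set
z ≈ w = (re z ≈ᴿ re w) × (im z ≈ᴿ im w)

fromℚ : ℚ → ℂ
fromℚ p = fromℚᴿ p +i fromℚᴿ 0ℚ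

0ℂ 1ℂ : ℂ
0ℂ = fromℚ 0ℚ
1ℂ = fromℚ 1ℚ

_+_ : ℂ → ℂ → ℂ
z + w = (re z +ᴿ re w) +i (im z +ᴿ im w)

-_ : ℂ → ℂ
- z = (-ᴿ re z) +i (-ᴿ im z)

_-_ : ℂ → ℂ → ℂ
z - w = z + (- w)

_*_ : ℂ → ℂ → ℂ
z * w = (re z *ᴿ re w +ᴿ -ᴿ (im z *ᴿ im w)) +i (re z *ᴿ im w +ᴿ im z *ᴿ re w)

_^_ : ℂ → ℕ → ℂ
z ^ zero  = 1ℂ
z ^ suc n = z * z ^ n

∣_∣² : ℂ → ℝ
∣ z ∣² = re z *ᴿ re z +ᴿ im z *ᴿ im z

-- Apartness: the constructive form of z ≠ w.
_#_ : ℂ → ℂ → Set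
z # w = fromℚᴿ 0ℚ <ᴿ ∣ z - w ∣²

-- q is the quotient a / b; in particular b ≠ 0.
IsQuotient : (a b q : ℂ) → Set
IsQuotient a b q = (b # 0ℂ) × (q * b ≈ a)

-- ∣ t ∣ < ρ in squared form; meant for ρ > 0 only.
_∈Disk_ : ℂ → ℚ → Set
t ∈Disk ρ = ∣ t ∣² <ᴿ fromℚᴿ (ρ ℚ.* ρ)

Near0 : (ℂ → Set) → Set
Near0 Q = ∃[ ρ ] (0ℚ ℚ.< ρ × (∀ t → t ∈Disk ρ → Q t))

sum< : ℕ → (ℕ → ℂ) → ℂ
sum< zero    a = 0ℂ
sum< (suc n) a = sum< n a + a n

HasSum : (ℕ → ℂ) → ℂ → Set
HasSum a s = ∀ ε → 0ℚ ℚ.< ε → ∃[ N ] (∀ n → N ℕ.≤ n → (sum< n a - s) ∈Disk ε)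

expSum : ℂ → ℕ → ℂ
expSum z n = sum< n (λ k → z ^ k * fromℚ (1/ k !))

-- If the rational approximations of z have real and imaginary part bounded
-- by M, then those of z ^ k / k! are bounded by u k = (2M)^k / k!, and
-- u (k + 1) ≤ u k / 2 as soon as k + 1 ≥ 4M.
module _ (z : ℂ) where

  private
    Bound : ℚ → ℂ → Set
    Bound B w = (∀ m → ∣ seq (re w) m ∣ ℚ.≤ B) × (∀ m → ∣ seq (im w) m ∣ ℚ.≤ B)

    abstract

      +-bound : ∀ p q {A B} → ∣ p ∣ ℚ.≤ A → ∣ q ∣ ℚ.≤ B → ∣ p ℚ.+ q ∣ ℚ.≤ A ℚ.+ B
      +-bound p q hp hq = ℚ.≤-trans (ℚ.∣p+q∣≤∣p∣+∣q∣ p q) (ℚ.+-mono-≤ hp hq)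

      neg-bound : ∀ p {A} → ∣ p ∣ ℚ.≤ A → ∣ ℚ.- p ∣ ℚ.≤ A
      neg-bound p {A} = subst (ℚ._≤ A) (sym (ℚ.∣-p∣≡∣p∣ p))

      *-bound : ∀ p q {A B} → ∣ p ∣ ℚ.≤ A → ∣ q ∣ ℚ.≤ B → ∣ p ℚ.* q ∣ ℚ.≤ A ℚ.* B
      *-bound p q {A} {B} hp hq = subst (ℚ._≤ A ℚ.* B) (sym (ℚ.∣p*q∣≡∣p∣*∣q∣ p q))
        (*-mono-≤₀ (ℚ.0≤∣p∣ q) (ℚ.≤-trans (ℚ.0≤∣p∣ p) hp) hp hq)

      z-bound : ∃[ M ] (0ℚ ℚ.< M × Bound M z)
      z-bound with cauchy⇒bounded (seq (re z)) (cauchy (re z)) | cauchy⇒bounded (seq (im z)) (cauchy (im z))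
      ... | A , A>0 , hA | B , B>0 , hB =
        A ℚ.+ B , ℚ.+-mono-< A>0 B>0 ,
        (λ m → subst (ℚ._≤ A ℚ.+ B) (ℚ.+-identityʳ _) (ℚ.+-mono-≤ (hA m) (ℚ.<⇒≤ B>0))) ,
        (λ m → subst (ℚ._≤ A ℚ.+ B) (ℚ.+-identityˡ _) (ℚ.+-mono-≤ (ℚ.<⇒≤ A>0) (hB m)))

    M c : ℚ
    M = proj₁ z-bound
    c = M ℚ.+ M

    pow : ℕ → ℚ
    pow zero    = 1ℚ
    pow (suc k) = c ℚ.* pow k

    u : ℕ → ℚ
    u k = pow k ℚ.* 1/ k !

    abstract

      c>0 : 0ℚ ℚ.< c
      c>0 = ℚ.+-mono-< (proj₁ (proj₂ z-bound)) (proj₁ (proj₂ z-bound))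

      pow>0 : ∀ k → 0ℚ ℚ.< pow k
      pow>0 zero    = ℚ.positive⁻¹ 1ℚ
      pow>0 (suc k) = *>0 c>0 (pow>0 k)

      1/!>0 : ∀ k → 0ℚ ℚ.< 1/ k !
      1/!>0 k = 1/>0 (k !) {{k ℕ.!≢0}}

      u>0 : ∀ k → 0ℚ ℚ.< u k
      u>0 k = *>0 (pow>0 k) (1/!>0 k)

      product-bound : ∀ a b x y {A B} → ∣ a ∣ ℚ.≤ A → ∣ b ∣ ℚ.≤ A → ∣ x ∣ ℚ.≤ B → ∣ y ∣ ℚ.≤ B →
                      ∣ a ℚ.* x ℚ.+ b ℚ.* y ∣ ℚ.≤ (A ℚ.+ A) ℚ.* B
      product-bound a b x y {A} {B} ha hb hx hy =
        subst (∣ a ℚ.* x ℚ.+ b ℚ.* y ∣ ℚ.≤_) (sym (ℚ.*-distribʳ-+ B A A))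
          (+-bound (a ℚ.* x) (b ℚ.* y) (*-bound a x ha hx) (*-bound b y hb hy))

      product-bound⁻ : ∀ a b x y {A B} → ∣ a ∣ ℚ.≤ A → ∣ b ∣ ℚ.≤ A → ∣ x ∣ ℚ.≤ B → ∣ y ∣ ℚ.≤ B →
                       ∣ a ℚ.* x ℚ.+ ℚ.- (b ℚ.* y) ∣ ℚ.≤ (A ℚ.+ A) ℚ.* B
      product-bound⁻ a b x y {A} {B} ha hb hx hy =
        subst (∣ a ℚ.* x ℚ.+ ℚ.- (b ℚ.* y) ∣ ℚ.≤_) (sym (ℚ.*-distribʳ-+ B A A))
          (+-bound (a ℚ.* x) (ℚ.- (b ℚ.* y)) (*-bound a x ha hx)
            (neg-bound (b ℚ.* y) (*-bound b y hb hy)))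

      pow-bound : ∀ k → Bound (pow k) (z ^ k)
      pow-bound zero    = (λ _ → ℚ.≤-refl) , (λ _ → ℚ.<⇒≤ (ℚ.positive⁻¹ 1ℚ))
      pow-bound (suc k) =
        (λ m → product-bound⁻ (seq (re z) m) (seq (im z) m) (seq (re (z ^ k)) m)
                 (seq (im (z ^ k)) m) {M} {pow k} (hr m) (hi m) (kr m) (ki m)) ,
        (λ m → product-bound (seq (re z) m) (seq (im z) m) (seq (im (z ^ k)) m)
                 (seq (re (z ^ k)) m) {M} {pow k} (hr m) (hi m) (ki m) (kr m))
        where
        hr : ∀ m → ∣ seq (re z) m ∣ ℚ.≤ M
        hr = proj₁ (proj₂ (proj₂ z-bound))
        hi : ∀ m → ∣ seq (im z) m ∣ ℚ.≤ M
        hi = proj₂ (proj₂ (proj₂ z-bound))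
        kr : ∀ m → ∣ seq (re (z ^ k)) m ∣ ℚ.≤ pow k
        kr = proj₁ (pow-bound k)
        ki : ∀ m → ∣ seq (im (z ^ k)) m ∣ ℚ.≤ pow k
        ki = proj₂ (pow-bound k)

      term-bound : ∀ k → Bound (u k) (z ^ k * fromℚ (1/ k !))
      term-bound k =
        (λ m → scale (seq (re (z ^ k)) m) (proj₁ (pow-bound k) m) (scale-re (seq (re (z ^ k)) m) (seq (im (z ^ k)) m))) ,
        (λ m → scale (seq (im (z ^ k)) m) (proj₂ (pow-bound k) m) (scale-im (seq (re (z ^ k)) m) (seq (im (z ^ k)) m)))
        where
        r : ℚ
        r = 1/ k !
        scale : ∀ a {x} → ∣ a ∣ ℚ.≤ pow k → x ≡ a ℚ.* r → ∣ x ∣ ℚ.≤ u k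
        scale a ha refl = *-bound a r ha (ℚ.≤-reflexive (ℚ.0≤p⇒∣p∣≡p (ℚ.<⇒≤ (1/!>0 k))))
        scale-re : ∀ a b → a ℚ.* r ℚ.+ ℚ.- (b ℚ.* 0ℚ) ≡ a ℚ.* r
        scale-re a b = trans (cong (λ x → a ℚ.* r ℚ.+ ℚ.- x) (ℚ.*-zeroʳ b)) (ℚ.+-identityʳ (a ℚ.* r))
        scale-im : ∀ a b → a ℚ.* 0ℚ ℚ.+ b ℚ.* r ≡ b ℚ.* r
        scale-im a b = trans (cong (ℚ._+ b ℚ.* r) (ℚ.*-zeroʳ a)) (ℚ.+-identityˡ (b ℚ.* r))

      4M≤ : ∃[ L ] c ℚ.+ c ℚ.< + L / 1
      4M≤ = archimedean (c ℚ.+ c)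

    L : ℕ
    L = proj₁ 4M≤

    abstract

      ratio : ∀ k → u (suc k) ≡ u k ℚ.* (c ℚ.* (+ 1 / suc k))
      ratio k = trans
        (cong (c ℚ.* pow k ℚ.*_)
          (1/-* (suc k) (k !) {{_}} {{k ℕ.!≢0}} {{suc k ℕ.!≢0}}))
        (solve 4 (λ a b d e → (a :* b) :* (d :* e) := (b :* e) :* (a :* d)) refl
          c (pow k) (+ 1 / suc k) (1/ k !))
        where open +-*-Solver

      ratio≤½ : ∀ k → L ℕ.≤ k → c ℚ.* (+ 1 / suc k) ℚ.≤ ½
      ratio≤½ k L≤k = begin
        c ℚ.* r                     ≡⟨ solve 2 (λ a b → a :* b := con ½ :* ((a :+ a) :* b)) refl c r ⟩
        ½ ℚ.* ((c ℚ.+ c) ℚ.* r)     ≤⟨ ℚ.*-monoˡ-≤-nonNeg ½ (ℚ.*-monoʳ-≤-nonNeg r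
                                         {{ℚ.nonNegative (ℚ.<⇒≤ (1/>0 (suc k)))}}
                                         (ℚ.≤-trans (ℚ.<⇒≤ (proj₂ 4M≤))
                                           (/1-mono {L} {suc k} (ℕ.m≤n⇒m≤1+n L≤k)))) ⟩
        ½ ℚ.* ((+ suc k / 1) ℚ.* r) ≡⟨ cong (½ ℚ.*_) (/1-*-inverse k) ⟩
        ½ ℚ.* 1ℚ                    ≡⟨⟩
        ½                           ∎
        where
        open ℚ.≤-Reasoning
        open +-*-Solver
        r : ℚ
        r = + 1 / suc k

      u-halves : ∀ k → L ℕ.≤ k → u (suc k) ℚ.≤ u k ℚ.* ½
      u-halves k L≤k = subst (ℚ._≤ u k ℚ.* ½) (sym (ratio k))
        (ℚ.*-monoˡ-≤-nonNeg (u k) {{ℚ.nonNegative (ℚ.<⇒≤ (u>0 k))}} (ratio≤½ k L≤k))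

      u-decays : ∀ j → u (j ℕ.+ L) ℚ.* (+ suc j / 1) ℚ.≤ u L
      u-decays zero    = ℚ.≤-reflexive (ℚ.*-identityʳ (u L))
      u-decays (suc j) = begin
        u (suc j ℕ.+ L) ℚ.* (+ suc (suc j) / 1)
          ≤⟨ ℚ.*-monoʳ-≤-nonNeg (+ suc (suc j) / 1)
               {{ℚ.nonNegative (/1-mono {0} {suc (suc j)} ℕ.z≤n)}}
               (u-halves (j ℕ.+ L) (ℕ.m≤n+m L j)) ⟩
        (v ℚ.* ½) ℚ.* (+ suc (suc j) / 1)
          ≡⟨ cong ((v ℚ.* ½) ℚ.*_) (/1-suc (suc j)) ⟩
        (v ℚ.* ½) ℚ.* (w ℚ.+ 1ℚ)
          ≤⟨ ℚ.*-monoˡ-≤-nonNeg (v ℚ.* ½) {{ℚ.nonNegative (ℚ.<⇒≤ (half>0 (u>0 (j ℕ.+ L))))}}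
               (ℚ.+-monoʳ-≤ w (/1-mono {1} {suc j} (ℕ.s≤s ℕ.z≤n))) ⟩
        (v ℚ.* ½) ℚ.* (w ℚ.+ w)
          ≡⟨ solve 2 (λ a b → (a :* con ½) :* (b :+ b) := a :* b) refl v w ⟩
        v ℚ.* w
          ≤⟨ u-decays j ⟩
        u L ∎
        where
        open ℚ.≤-Reasoning
        open +-*-Solver
        v : ℚ
        v = u (j ℕ.+ L)
        w : ℚ
        w = + suc j / 1

      u-small : ∀ ε → 0ℚ ℚ.< ε → ∃[ K ] (L ℕ.≤ K × u K ℚ.< ε)
      u-small ε ε>0 = choose (divide (u L) ε (u>0 L) ε>0)
        where
        open ℚ.≤-Reasoning
        below : ∀ q → 0ℚ ℚ.< q → q ℚ.* ε ≡ u L → ∃[ j ] q ℚ.< + j / 1 →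
                ∃[ K ] (L ℕ.≤ K × u K ℚ.< ε)
        below q q>0 e (j , q<j) = j ℕ.+ L , ℕ.m≤n+m L j ,
          ℚ.*-cancelʳ-<-nonNeg w {{ℚ.nonNegative (ℚ.<⇒≤ w>0)}} (begin-strict
            u (j ℕ.+ L) ℚ.* w  ≤⟨ u-decays j ⟩
            u L                ≡⟨ e ⟨
            q ℚ.* ε            <⟨ ℚ.*-monoˡ-<-pos ε {{ℚ.positive ε>0}} q<w ⟩
            w ℚ.* ε            ≡⟨ ℚ.*-comm w ε ⟩
            ε ℚ.* w            ∎)
          where
          w : ℚ
          w = + suc j / 1
          q<w : q ℚ.< w
          q<w = ℚ.<-≤-trans q<j (/1-mono {j} {suc j} (ℕ.n≤1+n j))
          w>0 : 0ℚ ℚ.< w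
          w>0 = ℚ.<-trans q>0 q<w
        choose : ∃[ q ] (0ℚ ℚ.< q × q ℚ.* ε ≡ u L) → ∃[ K ] (L ℕ.≤ K × u K ℚ.< ε)
        choose (q , q>0 , e) = below q q>0 e (archimedean q)

      -- A sequence whose increments are bounded by u, evaluated along the
      -- diagonal, is Cauchy.
      diagonal : (S : ℕ → ℕ → ℚ) → (∀ k → IsCauchy (S k)) →
                 (∀ k m → ∣ S (suc k) m ℚ.- S k m ∣ ℚ.≤ u k) →
                 IsCauchy (λ n → S n n)
      diagonal S cS inc ε ε>0 = choose (u-small e (half>0 (half>0 (half>0 ε>0))))
        where
        open ℚ.≤-Reasoning
        open +-*-Solver
        e : ℚ
        e = ε ℚ.* ½ ℚ.* ½ ℚ.* ½

        e-sum : (e ℚ.+ e) ℚ.+ (ε ℚ.* ½ ℚ.+ (e ℚ.+ e)) ≡ ε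
        e-sum = solve 1 (λ x →
          (x :* con ½ :* con ½ :* con ½ :+ x :* con ½ :* con ½ :* con ½) :+
          (x :* con ½ :+ (x :* con ½ :* con ½ :* con ½ :+ x :* con ½ :* con ½ :* con ½)) := x) refl ε

        module _ (K : ℕ) (L≤K : L ℕ.≤ K) (uK< : u K ℚ.< e) (N : ℕ)
          (h : ∀ m n → N ℕ.≤ m → N ℕ.≤ n → ∣ S K m ℚ.- S K n ∣ ℚ.< ε ℚ.* ½) where

          tail : ∀ i m → ∣ S (i ℕ.+ K) m ℚ.- S K m ∣ ℚ.≤ (u K ℚ.- u (i ℕ.+ K)) ℚ.+ (u K ℚ.- u (i ℕ.+ K))
          tail zero m = ℚ.≤-reflexive (trans (cong ∣_∣ (ℚ.+-inverseʳ (S K m)))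
            (solve 1 (λ a → con 0ℚ := (a :- a) :+ (a :- a)) refl (u K)))
          tail (suc i) m = begin
            ∣ S (suc i ℕ.+ K) m ℚ.- S K m ∣
              ≤⟨ triangle (S (suc i ℕ.+ K) m) (S (i ℕ.+ K) m) (S K m) ⟩
            ∣ S (suc i ℕ.+ K) m ℚ.- S (i ℕ.+ K) m ∣ ℚ.+ ∣ S (i ℕ.+ K) m ℚ.- S K m ∣
              ≤⟨ ℚ.+-mono-≤ (inc (i ℕ.+ K) m) (tail i m) ⟩
            a ℚ.+ ((u K ℚ.- a) ℚ.+ (u K ℚ.- a))
              ≡⟨ solve 2 (λ x y → x :+ ((y :- x) :+ (y :- x)) :=
                   (y :- x :* con ½) :+ (y :- x :* con ½)) refl a (u K) ⟩
            (u K ℚ.- a ℚ.* ½) ℚ.+ (u K ℚ.- a ℚ.* ½)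
              ≤⟨ ℚ.+-mono-≤ step step ⟩
            (u K ℚ.- u (suc i ℕ.+ K)) ℚ.+ (u K ℚ.- u (suc i ℕ.+ K)) ∎
            where
            a : ℚ
            a = u (i ℕ.+ K)
            step : u K ℚ.- a ℚ.* ½ ℚ.≤ u K ℚ.- u (suc i ℕ.+ K)
            step = ℚ.+-monoʳ-≤ (u K) (ℚ.neg-antimono-≤
              (u-halves (i ℕ.+ K) (ℕ.≤-trans L≤K (ℕ.m≤n+m K i))))

          tail< : ∀ n m → K ℕ.≤ n → ∣ S n m ℚ.- S K m ∣ ℚ.< e ℚ.+ e
          tail< n m K≤n = subst (λ i → ∣ S i m ℚ.- S K m ∣ ℚ.< e ℚ.+ e) (ℕ.m∸n+n≡m K≤n)
            (ℚ.≤-<-trans (tail (n ℕ.∸ K) m) (ℚ.+-mono-< drop drop))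
            where
            drop : u K ℚ.- u (n ℕ.∸ K ℕ.+ K) ℚ.< e
            drop = subst (u K ℚ.- u (n ℕ.∸ K ℕ.+ K) ℚ.<_) (ℚ.+-identityʳ e)
              (ℚ.+-mono-< uK< (ℚ.neg-antimono-< (u>0 (n ℕ.∸ K ℕ.+ K))))

          close : ∀ m n → N ℕ.⊔ K ℕ.≤ m → N ℕ.⊔ K ℕ.≤ n → ∣ S m m ℚ.- S n n ∣ ℚ.< ε
          close m n p q = begin-strict
            ∣ S m m ℚ.- S n n ∣
              ≤⟨ triangle (S m m) (S K m) (S n n) ⟩
            ∣ S m m ℚ.- S K m ∣ ℚ.+ ∣ S K m ℚ.- S n n ∣
              ≤⟨ ℚ.+-monoʳ-≤ ∣ S m m ℚ.- S K m ∣ (triangle (S K m) (S K n) (S n n)) ⟩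
            ∣ S m m ℚ.- S K m ∣ ℚ.+ (∣ S K m ℚ.- S K n ∣ ℚ.+ ∣ S K n ℚ.- S n n ∣)
              <⟨ ℚ.+-mono-< (tail< m m (ℕ.m⊔n≤o⇒n≤o N K p))
                   (ℚ.+-mono-< (h m n (ℕ.m⊔n≤o⇒m≤o N K p) (ℕ.m⊔n≤o⇒m≤o N K q))
                     (subst (ℚ._< e ℚ.+ e) (∣-∣-sym (S n n) (S K n)) (tail< n n (ℕ.m⊔n≤o⇒n≤o N K q)))) ⟩
            (e ℚ.+ e) ℚ.+ (ε ℚ.* ½ ℚ.+ (e ℚ.+ e))
              ≡⟨ e-sum ⟩
            ε ∎

        choose : ∃[ K ] (L ℕ.≤ K × u K ℚ.< e) →
                 ∃[ N ] (∀ m n → N ℕ.≤ m → N ℕ.≤ n → ∣ S m m ℚ.- S n n ∣ ℚ.< ε)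
        choose (K , L≤K , uK<) = N ℕ.⊔ K , close K L≤K uK< N (proj₂ (cS K (ε ℚ.* ½) (half>0 ε>0)))
          where
          N : ℕ
          N = proj₁ (cS K (ε ℚ.* ½) (half>0 ε>0))

      cancel : ∀ a b → (a ℚ.+ b) ℚ.- a ≡ b
      cancel = solve 2 (λ a b → (a :+ b) :- a := b) refl
        where open +-*-Solver

  abstract

    exp-re-cauchy : IsCauchy (λ n → seq (re (expSum z n)) n)
    exp-re-cauchy = diagonal (λ k → seq (re (expSum z k))) (λ k → cauchy (re (expSum z k)))
      (λ k m → subst (λ x → ∣ x ∣ ℚ.≤ u k) (sym (cancel (seq (re (expSum z k)) m) _))
        (proj₁ (term-bound k) m))

    exp-im-cauchy : IsCauchy (λ n → seq (im (expSum z n)) n)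
    exp-im-cauchy = diagonal (λ k → seq (im (expSum z k))) (λ k → cauchy (im (expSum z k)))
      (λ k m → subst (λ x → ∣ x ∣ ℚ.≤ u k) (sym (cancel (seq (im (expSum z k)) m) _))
        (proj₂ (term-bound k) m))

-- exp z = ∑ z ^ k / k!. The n-th rational approximation is the n-th partial
-- sum of the series at the n-th rational approximation of z.
exp : ℂ → ℂ
exp z = mkℝ (λ n → seq (re (expSum z n)) n) (exp-re-cauchy z)
     +i mkℝ (λ n → seq (im (expSum z n)) n) (exp-im-cauchy z)

-- s is confined to the disk so that f s makes sense; the bound is
-- ∣ f s − f t − d (s − t) ∣ ≤ ε ∣ s − t ∣, squared.
HasDerivative : (r : ℚ) (f : ∀ t → t ∈Disk r → ℂ) (t : ℂ) → t ∈Disk r → ℂ → Set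
HasDerivative r f t t∈ d = ∀ ε → 0ℚ ℚ.< ε → ∃[ δ ] (0ℚ ℚ.< δ × (∀ s (s∈ : s ∈Disk r) →
  (s - t) ∈Disk δ →
  ∣ f s s∈ - f t t∈ - d * (s - t) ∣² ≤ᴿ fromℚᴿ (ε ℚ.* ε) *ᴿ ∣ s - t ∣²))

-- The domain of fun is only a disk, so fun takes a membership proof; the
-- representative (radius, fun) matters only through its germ at 0.
record HolomorphicAt0 : Set where
  field
    radius         : ℚ
    radius>0       : 0ℚ ℚ.< radius
    fun            : ∀ t → t ∈Disk radius → ℂ
    fun-cong       : ∀ {s t} (s∈ : s ∈Disk radius) (t∈ : t ∈Disk radius) →
                     s ≈ t → fun s s∈ ≈ fun t t∈
    differentiable : ∀ t (t∈ : t ∈Disk radius) → ∃[ d ] HasDerivative radius fun t t∈ d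

abstract

  0∈Disk : ∀ {ρ} → 0ℚ ℚ.< ρ → 0ℂ ∈Disk ρ
  0∈Disk {ρ} ρ>0 = ρ² ℚ.* ½ , half>0 {ρ²} ρ²>0 , 0 , λ _ _ → begin-strict
    0ℚ ℚ.+ ρ² ℚ.* ½         ≡⟨ ℚ.+-identityˡ (ρ² ℚ.* ½) ⟩
    ρ² ℚ.* ½                ≡⟨ ℚ.+-identityʳ (ρ² ℚ.* ½) ⟨
    ρ² ℚ.* ½ ℚ.+ 0ℚ         <⟨ ℚ.+-monoʳ-< (ρ² ℚ.* ½) (half>0 {ρ²} ρ²>0) ⟩
    ρ² ℚ.* ½ ℚ.+ ρ² ℚ.* ½   ≡⟨ half+half ρ² ⟩
    ρ²                      ∎
    where
    open ℚ.≤-Reasoning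
    ρ² : ℚ
    ρ² = ρ ℚ.* ρ
    ρ²>0 : 0ℚ ℚ.< ρ²
    ρ²>0 = *>0 ρ>0 ρ>0

at0 : HolomorphicAt0 → ℂ
at0 f = fun 0ℂ (0∈Disk radius>0)
  where open HolomorphicAt0 f

-- Q t (f t) for all t in the domain of f that lie in some disk around 0.
Near0[_] : HolomorphicAt0 → (ℂ → ℂ → Set) → Set
Near0[ f ] Q = Near0 (λ t → (t∈ : t ∈Disk radius) → Q t (fun t t∈))
  where open HolomorphicAt0 f

-- Coefficient list, constant term first.
Poly : Set
Poly = List ℂ

eval : Poly → ℂ → ℂ
eval p x = foldr (λ a v → a + x * v) 0ℂ p

EGF : (P : ℕ → Poly) (x t s : ℂ) → Set
EGF P x t s = HasSum (λ n → eval (P n) x * (t ^ n * fromℚ (1/ n !))) s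

-- ∑ B_n(x) t^n / n! = t e^{xt} / (e^t − 1) for t ≠ 0 close to 0.
-- The quotient is undefined at t = 0, where its value is the limit, and is
-- therefore not constrained there; this determines B.
IsBernoulli : (ℕ → Poly) → Set
IsBernoulli B = ∀ x → Near0 (λ t → t # 0ℂ →
  ∃[ s ] (EGF B x t s × IsQuotient (t * exp (x * t)) (exp t - 1ℂ) s))

-- ∑_{k=0}^{N} B_k(0) t^k / k!
bernoulliSum : (B : ℕ → Poly) (N : ℕ) → ℂ → ℂ
bernoulliSum B N t = sum< (suc N) (λ k → eval (B k) 0ℂ * (t ^ k * fromℚ (1/ k !)))

-- g(−t) = g(t) for t in some disk around 0; g is only defined for ∣ t ∣ < r.
EvenNear0 : (r : ℚ) → (∀ t → t ∈Disk r → ℂ) → Set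
EvenNear0 r g = Near0 (λ t → (t∈ : t ∈Disk r) (-t∈ : (- t) ∈Disk r) → g (- t) -t∈ ≈ g t t∈)

{-# OPTIONS --safe #-}

-- The symmetry of P compares the generating functions of P(1) at t and of
-- P(0) at −t, giving f(t) eᵗ = f(−t). As f(0) ≠ 0, applying this twice gives
-- eᵗ e⁻ᵗ = 1 near 0. With that, the Bernoulli generating function satisfies
-- b(−t) − b(t) = t, so Bₙ(0) = 0 for odd n > 1 and B₁(0) = −1/2; hence the odd
-- part of every partial sum with N ≥ 1 is −t/2, and evenness of F turns into
-- f(−t) − f(t) = t. Together: f(t) (eᵗ − 1) = t. The coefficients are then
-- compared by the identity theorem for power series, for which it is enough
-- to evaluate at small positive rationals, where exp is the sum of its series.

module Submission where

open import Defs
open import Algebra.Bundles using (CommutativeRing)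
import Algebra.Solver.Ring
open import Algebra.Solver.Ring.AlmostCommutativeRing
  using (AlmostCommutativeRing; fromCommutativeRing; _-Raw-AlmostCommutative⟶_)
open import Data.Maybe.Base using (just; nothing)
open import Data.Nat.Base as ℕ using (ℕ; zero; suc; NonZero; _!)
import Data.Nat.Properties as ℕ
open import Data.Product.Base using (∃-syntax; _×_; _,_; proj₁; proj₂)
open import Data.Rational.Base as ℚ using (ℚ; 0ℚ; 1ℚ; ½; ∣_∣)
import Data.Rational.Properties as ℚ
open import Data.Rational.Solver using (module +-*-Solver)
open import Data.Sum.Base using (inj₁; inj₂)
open import Data.Unit.Base using (tt)
open import Function.Base using (_∘_)
open import Level using (0ℓ)
open import Relation.Binary.Bundles using (Setoid)
open import Relation.Binary.Definitions using (WeaklyDecidable)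
open import Relation.Binary.PropositionalEquality
  using (_≡_; refl; sym; trans; cong; cong₂; subst; subst₂)
import Relation.Binary.Reasoning.Setoid
open import Relation.Nullary using (yes; no; contradiction)

-- Equality in ℂ is a statement about limits, whereas the ring laws hold for each rational
-- approximation separately. The algebra is therefore done for `_≐_`, which `exp` respects as well,
-- and its results are imported into the analytic equality `_≃_`. Obtaining `exp t * exp (- t) = 1`
-- from the symmetry of P takes the place of multiplying two exponential series. In the same spirit
-- `exp (x * t)` for general x is only carried along as a factor common to both generating
-- functions, so that the series of `exp` is summed at rational points alone. The equation f(t) (eᵗ
-- - 1) = t reads 0 = 0 at t = 0. The value f(0) = 1 is found as a limit: f(q) · (e^q - 1)/q = 1 for
-- small rational q > 0, where f(q) tends to f(0) because f is the sum of the series with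
-- coefficients P_n(0)/n!, and (e^q - 1)/q tends to 1.

infix  4 _≐_
infixr 4 _,≐_

-- Equality of all rational approximations: for it the ring laws of ℂ are
-- identities in ℚ.
record _≐_ (z w : ℂ) : Set where
  constructor _,≐_
  field
    re≡ : ∀ m → seq (re z) m ≡ seq (re w) m
    im≡ : ∀ m → seq (im z) m ≡ seq (im w) m

open _≐_

≐-refl : ∀ {z} → z ≐ z
≐-refl = (λ _ → refl) ,≐ (λ _ → refl)

≐-sym : ∀ {z w} → z ≐ w → w ≐ z
≐-sym (r ,≐ i) = (λ m → sym (r m)) ,≐ (λ m → sym (i m))

≐-trans : ∀ {z w v} → z ≐ w → w ≐ v → z ≐ v
≐-trans (r ,≐ i) (r′ ,≐ i′) = (λ m → trans (r m) (r′ m)) ,≐ (λ m → trans (i m) (i′ m))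

+-cong≐ : ∀ {z z′ w w′} → z ≐ z′ → w ≐ w′ → z + w ≐ z′ + w′
+-cong≐ (r ,≐ i) (r′ ,≐ i′) =
  (λ m → cong₂ ℚ._+_ (r m) (r′ m)) ,≐ (λ m → cong₂ ℚ._+_ (i m) (i′ m))

neg-cong≐ : ∀ {z w} → z ≐ w → - z ≐ - w
neg-cong≐ (r ,≐ i) = (λ m → cong ℚ.-_ (r m)) ,≐ (λ m → cong ℚ.-_ (i m))

*-cong≐ : ∀ {z z′ w w′} → z ≐ z′ → w ≐ w′ → z * w ≐ z′ * w′
*-cong≐ (r ,≐ i) (r′ ,≐ i′) =
  (λ m → cong₂ ℚ._+_ (cong₂ ℚ._*_ (r m) (r′ m)) (cong ℚ.-_ (cong₂ ℚ._*_ (i m) (i′ m)))) ,≐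
  (λ m → cong₂ ℚ._+_ (cong₂ ℚ._*_ (r m) (i′ m)) (cong₂ ℚ._*_ (i m) (r′ m)))

-- Ring structure and ring solver for ℂ

private
  *-assoc≐ : ∀ z w v → (z * w) * v ≐ z * (w * v)
  *-assoc≐ z w v =
    (λ m → solve 6 (λ a b c d e f →
      (a :* c :- b :* d) :* e :- (a :* d :+ b :* c) :* f :=
      a :* (c :* e :- d :* f) :- b :* (c :* f :+ d :* e)) refl
      (seq (re z) m) (seq (im z) m) (seq (re w) m) (seq (im w) m) (seq (re v) m) (seq (im v) m)) ,≐
    (λ m → solve 6 (λ a b c d e f →
      (a :* c :- b :* d) :* f :+ (a :* d :+ b :* c) :* e :=
      a :* (c :* f :+ d :* e) :+ b :* (c :* e :- d :* f)) refl
      (seq (re z) m) (seq (im z) m) (seq (re w) m) (seq (im w) m) (seq (re v) m) (seq (im v) m))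
    where open +-*-Solver

  *-comm≐ : ∀ z w → z * w ≐ w * z
  *-comm≐ z w =
    (λ m → solve 4 (λ a b c d → a :* c :- b :* d := c :* a :- d :* b) refl
      (seq (re z) m) (seq (im z) m) (seq (re w) m) (seq (im w) m)) ,≐
    (λ m → solve 4 (λ a b c d → a :* d :+ b :* c := c :* b :+ d :* a) refl
      (seq (re z) m) (seq (im z) m) (seq (re w) m) (seq (im w) m))
    where open +-*-Solver

  *-identityˡ≐ : ∀ z → 1ℂ * z ≐ z
  *-identityˡ≐ z =
    (λ m → solve 2 (λ a b → con 1ℚ :* a :- con 0ℚ :* b := a) refl (seq (re z) m) (seq (im z) m)) ,≐
    (λ m → solve 2 (λ a b → con 1ℚ :* b :+ con 0ℚ :* a := b) refl (seq (re z) m) (seq (im z) m))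
    where open +-*-Solver

  *-distribˡ≐ : ∀ z w v → z * (w + v) ≐ z * w + z * v
  *-distribˡ≐ z w v =
    (λ m → solve 6 (λ a b c d e f →
      a :* (c :+ e) :- b :* (d :+ f) := (a :* c :- b :* d) :+ (a :* e :- b :* f)) refl
      (seq (re z) m) (seq (im z) m) (seq (re w) m) (seq (im w) m) (seq (re v) m) (seq (im v) m)) ,≐
    (λ m → solve 6 (λ a b c d e f →
      a :* (d :+ f) :+ b :* (c :+ e) := (a :* d :+ b :* c) :+ (a :* f :+ b :* e)) refl
      (seq (re z) m) (seq (im z) m) (seq (re w) m) (seq (im w) m) (seq (re v) m) (seq (im v) m))
    where open +-*-Solver

+-*-commutativeRing : CommutativeRing 0ℓ 0ℓ
+-*-commutativeRing = record
  { Carrier = ℂ ; _≈_ = _≐_ ; _+_ = _+_ ; _*_ = _*_ ; -_ = -_ ; 0# = 0ℂ ; 1# = 1ℂ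
  ; isCommutativeRing = record
    { isRing = record
      { +-isAbelianGroup = record
        { isGroup = record
          { isMonoid = record
            { isSemigroup = record
              { isMagma = record
                { isEquivalence = record { refl = ≐-refl ; sym = ≐-sym ; trans = ≐-trans }
                ; ∙-cong = +-cong≐ }
              ; assoc = λ z w v →
                (λ m → ℚ.+-assoc (seq (re z) m) (seq (re w) m) (seq (re v) m)) ,≐
                (λ m → ℚ.+-assoc (seq (im z) m) (seq (im w) m) (seq (im v) m)) }
            ; identity = (λ z → (λ m → ℚ.+-identityˡ (seq (re z) m)) ,≐ (λ m → ℚ.+-identityˡ (seq (im z) m))) ,
                         (λ z → (λ m → ℚ.+-identityʳ (seq (re z) m)) ,≐ (λ m → ℚ.+-identityʳ (seq (im z) m))) }
          ; inverse = (λ z → (λ m → ℚ.+-inverseˡ (seq (re z) m)) ,≐ (λ m → ℚ.+-inverseˡ (seq (im z) m))) ,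
                      (λ z → (λ m → ℚ.+-inverseʳ (seq (re z) m)) ,≐ (λ m → ℚ.+-inverseʳ (seq (im z) m)))
          ; ⁻¹-cong = neg-cong≐ }
        ; comm = λ z w →
            (λ m → ℚ.+-comm (seq (re z) m) (seq (re w) m)) ,≐
            (λ m → ℚ.+-comm (seq (im z) m) (seq (im w) m)) }
      ; *-cong = *-cong≐
      ; *-assoc = *-assoc≐
      ; *-identity = *-identityˡ≐ , (λ z → ≐-trans (*-comm≐ z 1ℂ) (*-identityˡ≐ z))
      ; distrib = *-distribˡ≐ , (λ z w v → ≐-trans (*-comm≐ (w + v) z)
          (≐-trans (*-distribˡ≐ z w v) (+-cong≐ (*-comm≐ z w) (*-comm≐ z v)))) }
    ; *-comm = *-comm≐ } }

fromℚ-* : ∀ p q → fromℚ (p ℚ.* q) ≐ fromℚ p * fromℚ q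
fromℚ-* p q =
  (λ _ → solve 2 (λ p q → p :* q := p :* q :- con 0ℚ :* con 0ℚ) refl p q) ,≐
  (λ _ → solve 2 (λ p q → con 0ℚ := p :* con 0ℚ :+ con 0ℚ :* q) refl p q)
  where open +-*-Solver

fromℚ-inverse : ∀ y q → y ℚ.* q ≡ 1ℚ → fromℚ y * fromℚ q ≐ 1ℂ
fromℚ-inverse y q yq≡1 = ≐-trans (≐-sym (fromℚ-* y q)) ((λ _ → yq≡1) ,≐ (λ _ → refl))

ℂ-ring : AlmostCommutativeRing 0ℓ 0ℓ
ℂ-ring = fromCommutativeRing +-*-commutativeRing

fromℚ-homomorphism :
  CommutativeRing.rawRing ℚ.+-*-commutativeRing -Raw-AlmostCommutative⟶ ℂ-ring
fromℚ-homomorphism = record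
  { ⟦_⟧    = fromℚ
  ; +-homo = λ _ _ → (λ _ → refl) ,≐ (λ _ → refl)
  ; *-homo = fromℚ-*
  ; -‿homo = λ _ → (λ _ → refl) ,≐ (λ _ → refl)
  ; 0-homo = ≐-refl
  ; 1-homo = ≐-refl
  }

fromℚ≟ : WeaklyDecidable (λ p q → fromℚ p ≐ fromℚ q)
fromℚ≟ p q with p ℚ.≟ q
... | yes refl = just ≐-refl
... | no  _    = nothing

-- The coefficients are rational, so that the solver can decide their equality.
module ℂ-Solver = Algebra.Solver.Ring
  (CommutativeRing.rawRing ℚ.+-*-commutativeRing) ℂ-ring fromℚ-homomorphism fromℚ≟

^-distrib-* : ∀ z w n → (z * w) ^ n ≐ z ^ n * w ^ n
^-distrib-* z w zero    = ≐-sym (*-identityˡ≐ 1ℂ)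
^-distrib-* z w (suc n) = ≐-trans (*-cong≐ ≐-refl (^-distrib-* z w n))
  (solve 4 (λ z w a b → (z :* w) :* (a :* b) := (z :* a) :* (w :* b)) ≐-refl z w (z ^ n) (w ^ n))
  where open ℂ-Solver

^-cong≐ : ∀ {z w} n → z ≐ w → z ^ n ≐ w ^ n
^-cong≐ zero    _ = ≐-refl
^-cong≐ (suc n) p = *-cong≐ p (^-cong≐ n p)

sum<-cong≐ : ∀ n {a b} → (∀ k → a k ≐ b k) → sum< n a ≐ sum< n b
sum<-cong≐ zero    _ = ≐-refl
sum<-cong≐ (suc n) p = +-cong≐ (sum<-cong≐ n p) (p n)

-- The n-th approximation of `exp z` depends only on the n-th approximation of z, so no estimate is
-- involved.
exp-cong≐ : ∀ {z w} → z ≐ w → exp z ≐ exp w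
exp-cong≐ {z} {w} p = (λ n → re≡ (partial n) n) ,≐ (λ n → im≡ (partial n) n)
  where
  partial : ∀ n → expSum z n ≐ expSum w n
  partial n = sum<-cong≐ n (λ k → *-cong≐ (^-cong≐ k p) ≐-refl)

-- Smallness and equality in ℂ

infix 4 _≺_ _≃_

∣+∣< : ∀ p q {α β} → ∣ p ∣ ℚ.< α → ∣ q ∣ ℚ.< β → ∣ p ℚ.+ q ∣ ℚ.< α ℚ.+ β
∣+∣< p q p< q< = ℚ.≤-<-trans (ℚ.∣p+q∣≤∣p∣+∣q∣ p q) (ℚ.+-mono-< p< q<)

∣*∣< : ∀ p q {α β} → ∣ p ∣ ℚ.< α → ∣ q ∣ ℚ.< β → ∣ p ℚ.* q ∣ ℚ.< α ℚ.* β
∣*∣< p q {α} {β} p< q< = subst (ℚ._< α ℚ.* β) (sym (ℚ.∣p*q∣≡∣p∣*∣q∣ p q)) (ℚ.≤-<-trans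
  (ℚ.*-monoˡ-≤-nonNeg ∣ p ∣ {{ℚ.∣-∣-nonNeg p}} (ℚ.<⇒≤ q<))
  (ℚ.*-monoˡ-<-pos β {{ℚ.positive (ℚ.≤-<-trans (ℚ.0≤∣p∣ q) q<)}} p<))

∣-∣< : ∀ p {α} → ∣ p ∣ ℚ.< α → ∣ ℚ.- p ∣ ℚ.< α
∣-∣< p {α} = subst (ℚ._< α) (sym (ℚ.∣-p∣≡∣p∣ p))

≤∣∣ : ∀ p → p ℚ.≤ ∣ p ∣
≤∣∣ p with ℚ.≤-total 0ℚ p
... | inj₁ 0≤p = ℚ.≤-reflexive (sym (ℚ.0≤p⇒∣p∣≡p 0≤p))
... | inj₂ p≤0 = ℚ.≤-trans p≤0 (ℚ.0≤∣p∣ p)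

sq-∣∣ : ∀ p → ∣ p ∣ ℚ.* ∣ p ∣ ≡ p ℚ.* p
sq-∣∣ p with ℚ.∣p∣≡p∨∣p∣≡-p p
... | inj₁ e = cong₂ ℚ._*_ e e
... | inj₂ e = trans (cong₂ ℚ._*_ e e) (solve 1 (λ p → (:- p) :* (:- p) := p :* p) refl p)
  where open +-*-Solver

sq≥0 : ∀ p → 0ℚ ℚ.≤ p ℚ.* p
sq≥0 p = subst₂ ℚ._≤_ (ℚ.*-zeroˡ 0ℚ) (sq-∣∣ p)
  (*-mono-≤₀ ℚ.≤-refl (ℚ.0≤∣p∣ p) (ℚ.0≤∣p∣ p) (ℚ.0≤∣p∣ p))

sq<sq⇒∣∣< : ∀ p {ε} → 0ℚ ℚ.< ε → p ℚ.* p ℚ.< ε ℚ.* ε → ∣ p ∣ ℚ.< ε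
sq<sq⇒∣∣< p {ε} ε>0 p²<ε² with ∣ p ∣ ℚ.<? ε
... | yes ∣p∣<ε = ∣p∣<ε
... | no  ∣p∣≮ε = contradiction refl (ℚ.<⇒≢ (ℚ.<-≤-trans p²<ε² (subst (ε ℚ.* ε ℚ.≤_) (sq-∣∣ p)
      (*-mono-≤₀ (ℚ.<⇒≤ ε>0) (ℚ.0≤∣p∣ p) (ℚ.≮⇒≥ ∣p∣≮ε) (ℚ.≮⇒≥ ∣p∣≮ε)))))

-- Real and imaginary part are bounded separately instead of the modulus: sums and products then
-- reduce to estimates in ℚ without square roots.
record _≺_ (z : ℂ) (ε : ℚ) : Set where
  constructor small
  field
    from : ℕ
    re<  : ∀ m → from ℕ.≤ m → ∣ seq (re z) m ∣ ℚ.< ε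
    im<  : ∀ m → from ℕ.≤ m → ∣ seq (im z) m ∣ ℚ.< ε

open _≺_

≺-resp-≐ : ∀ {z w ε} → z ≐ w → z ≺ ε → w ≺ ε
≺-resp-≐ {ε = ε} (r ,≐ i) (small N h k) = small N
  (λ m p → subst (λ x → ∣ x ∣ ℚ.< ε) (r m) (h m p))
  (λ m p → subst (λ x → ∣ x ∣ ℚ.< ε) (i m) (k m p))

≺-mono : ∀ {z ε δ} → ε ℚ.≤ δ → z ≺ ε → z ≺ δ
≺-mono ε≤δ (small N h k) = small N
  (λ m p → ℚ.<-≤-trans (h m p) ε≤δ) (λ m p → ℚ.<-≤-trans (k m p) ε≤δ)

≺⇒>0 : ∀ {z ε} → z ≺ ε → 0ℚ ℚ.< ε
≺⇒>0 {z} (small N h _) = ℚ.≤-<-trans (ℚ.0≤∣p∣ (seq (re z) N)) (h N ℕ.≤-refl)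

≺-+ : ∀ {z w ε δ} → z ≺ ε → w ≺ δ → z + w ≺ ε ℚ.+ δ
≺-+ {z} {w} (small M h k) (small N h′ k′) = small (M ℕ.⊔ N)
  (λ m p → ∣+∣< (seq (re z) m) (seq (re w) m) (h m (ℕ.m⊔n≤o⇒m≤o M N p)) (h′ m (ℕ.m⊔n≤o⇒n≤o M N p)))
  (λ m p → ∣+∣< (seq (im z) m) (seq (im w) m) (k m (ℕ.m⊔n≤o⇒m≤o M N p)) (k′ m (ℕ.m⊔n≤o⇒n≤o M N p)))

≺-neg : ∀ {z ε} → z ≺ ε → - z ≺ ε
≺-neg {z} (small N h k) = small N
  (λ m p → ∣-∣< (seq (re z) m) (h m p)) (λ m p → ∣-∣< (seq (im z) m) (k m p))

-- The factor 2 pays for bounding the real and imaginary parts separately.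
≺-* : ∀ {z w α β} → z ≺ α → w ≺ β → z * w ≺ α ℚ.* β ℚ.+ α ℚ.* β
≺-* {z} {w} (small M h k) (small N h′ k′) = small (M ℕ.⊔ N)
  (λ m p → ∣+∣< (seq (re z) m ℚ.* seq (re w) m) (ℚ.- (seq (im z) m ℚ.* seq (im w) m))
    (∣*∣< (seq (re z) m) (seq (re w) m) (h m (left p)) (h′ m (right p)))
    (∣-∣< (seq (im z) m ℚ.* seq (im w) m)
      (∣*∣< (seq (im z) m) (seq (im w) m) (k m (left p)) (k′ m (right p)))))
  (λ m p → ∣+∣< (seq (re z) m ℚ.* seq (im w) m) (seq (im z) m ℚ.* seq (re w) m)
    (∣*∣< (seq (re z) m) (seq (im w) m) (h m (left p)) (k′ m (right p)))
    (∣*∣< (seq (im z) m) (seq (re w) m) (k m (left p)) (h′ m (right p))))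
  where
  left : ∀ {m} → M ℕ.⊔ N ℕ.≤ m → M ℕ.≤ m
  left = ℕ.m⊔n≤o⇒m≤o M N
  right : ∀ {m} → M ℕ.⊔ N ℕ.≤ m → N ℕ.≤ m
  right = ℕ.m⊔n≤o⇒n≤o M N

≺-scale : ∀ {z ε} r → 0ℚ ℚ.< r → z ≺ ε → fromℚ r * z ≺ r ℚ.* ε
≺-scale {z} {ε} r r>0 (small N h k) = small N
  (λ m p → subst (ℚ._< r ℚ.* ε)
    (trans (sym (abs (seq (re z) m))) (cong ∣_∣ (solve 3 (λ r a b → r :* a := r :* a :- con 0ℚ :* b) refl
      r (seq (re z) m) (seq (im z) m))))
    (ℚ.*-monoʳ-<-pos r {{ℚ.positive r>0}} (h m p)))
  (λ m p → subst (ℚ._< r ℚ.* ε)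
    (trans (sym (abs (seq (im z) m))) (cong ∣_∣ (solve 3 (λ r a b → r :* b := r :* b :+ con 0ℚ :* a) refl
      r (seq (re z) m) (seq (im z) m))))
    (ℚ.*-monoʳ-<-pos r {{ℚ.positive r>0}} (k m p)))
  where
  open +-*-Solver
  abs : ∀ a → ∣ r ℚ.* a ∣ ≡ r ℚ.* ∣ a ∣
  abs a = trans (ℚ.∣p*q∣≡∣p∣*∣q∣ r a) (cong (ℚ._* ∣ a ∣) (ℚ.0≤p⇒∣p∣≡p (ℚ.<⇒≤ r>0)))

0≺ : ∀ {ε} → 0ℚ ℚ.< ε → 0ℂ ≺ ε
0≺ ε>0 = small 0 (λ _ _ → ε>0) (λ _ _ → ε>0)

bounded : ∀ z → ∃[ B ] z ≺ B
bounded z with cauchy⇒bounded (seq (re z)) (cauchy (re z)) | cauchy⇒bounded (seq (im z)) (cauchy (im z))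
... | A , A>0 , hA | B , B>0 , hB = A ℚ.+ B , small 0
  (λ m _ → subst (ℚ._< A ℚ.+ B) (ℚ.+-identityʳ _) (ℚ.+-mono-≤-< (hA m) B>0))
  (λ m _ → subst (ℚ._< A ℚ.+ B) (ℚ.+-identityˡ _) (ℚ.+-mono-<-≤ A>0 (hB m)))

-- Dividing ε by C + 2ε meets both demands: the divisor is at least 2ε, which gives r ≤ ½, and at
-- least C, which gives r C ≤ ε.
shrink : ∀ {ε} C → 0ℚ ℚ.< ε → 0ℚ ℚ.< C → ∃[ r ] (0ℚ ℚ.< r × r ℚ.≤ ½ × r ℚ.* C ℚ.≤ ε)
shrink {ε} C ε>0 C>0 with divide ε (C ℚ.+ (ε ℚ.+ ε)) ε>0 (ℚ.+-mono-< C>0 (ℚ.+-mono-< ε>0 ε>0))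
... | r , r>0 , e = r , r>0 ,
    ℚ.*-cancelʳ-≤-pos (ε ℚ.+ ε) {{ℚ.positive (ℚ.+-mono-< ε>0 ε>0)}} (begin
      r ℚ.* (ε ℚ.+ ε)          ≤⟨ ℚ.*-monoˡ-≤-nonNeg r {{ℚ.nonNegative (ℚ.<⇒≤ r>0)}}
                                    (subst (ℚ._≤ C ℚ.+ (ε ℚ.+ ε)) (ℚ.+-identityˡ (ε ℚ.+ ε))
                                      (ℚ.+-monoˡ-≤ (ε ℚ.+ ε) (ℚ.<⇒≤ C>0))) ⟩
      r ℚ.* (C ℚ.+ (ε ℚ.+ ε))  ≡⟨ e ⟩
      ε                        ≡⟨ solve 1 (λ e → e := con ½ :* (e :+ e)) refl ε ⟩
      ½ ℚ.* (ε ℚ.+ ε)          ∎) ,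
    (begin
      r ℚ.* C                  ≤⟨ ℚ.*-monoˡ-≤-nonNeg r {{ℚ.nonNegative (ℚ.<⇒≤ r>0)}}
                                    (subst (ℚ._≤ C ℚ.+ (ε ℚ.+ ε)) (ℚ.+-identityʳ C)
                                      (ℚ.+-monoʳ-≤ C (ℚ.+-mono-≤ (ℚ.<⇒≤ ε>0) (ℚ.<⇒≤ ε>0)))) ⟩
      r ℚ.* (C ℚ.+ (ε ℚ.+ ε))  ≡⟨ e ⟩
      ε                        ∎)
  where
  open ℚ.≤-Reasoning
  open +-*-Solver

-- The same relation as `_≈_`, but as a record, from which z and w can be inferred; `_≈_` unfolds to
-- a product of function types.
record _≃_ (z w : ℂ) : Set where
  constructor arbitrarily-close
  field
    close : ∀ ε → 0ℚ ℚ.< ε → z - w ≺ ε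

open _≃_

≈⇒≃ : ∀ {z w} → z ≈ w → z ≃ w
≈⇒≃ (r , i) .close ε ε>0 with r ε ε>0 | i ε ε>0
... | M , h | N , k = small (M ℕ.⊔ N)
  (λ m p → h m (ℕ.m⊔n≤o⇒m≤o M N p)) (λ m p → k m (ℕ.m⊔n≤o⇒n≤o M N p))

≃⇒≈ : ∀ {z w} → z ≃ w → z ≈ w
≃⇒≈ e = (λ ε ε>0 → let s = e .close ε ε>0 in from s , re< s) ,
        (λ ε ε>0 → let s = e .close ε ε>0 in from s , im< s)

≐⇒≃ : ∀ {z w} → z ≐ w → z ≃ w
≐⇒≃ {z} {w} e .close ε ε>0 = ≺-resp-≐ (≐-trans
  (solve 1 (λ w → con 0ℚ := w :- w) ≐-refl w) (+-cong≐ (≐-sym e) ≐-refl)) (0≺ ε>0)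
  where open ℂ-Solver

≃-refl : ∀ {z} → z ≃ z
≃-refl = ≐⇒≃ ≐-refl

≃-sym : ∀ {z w} → z ≃ w → w ≃ z
≃-sym {z} {w} e .close ε ε>0 =
  ≺-resp-≐ (solve 2 (λ z w → :- (z :- w) := w :- z) ≐-refl z w) (≺-neg (e .close ε ε>0))
  where open ℂ-Solver

≺-resp-≃ : ∀ {z w ε δ} → z ≃ w → 0ℚ ℚ.< δ → z ≺ ε → w ≺ ε ℚ.+ δ
≺-resp-≃ {z} {w} {ε} {δ} e δ>0 z≺ =
  ≺-resp-≐ (solve 2 (λ z w → z :+ (w :- z) := w) ≐-refl z w)
    (≺-+ z≺ (≃-sym e .close δ δ>0))
  where open ℂ-Solver

≃-trans : ∀ {z w v} → z ≃ w → w ≃ v → z ≃ v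
≃-trans {z} {w} {v} e e′ .close ε ε>0 = subst (z - v ≺_) (half+half ε)
  (≺-resp-≐ (solve 3 (λ z w v → (z :- w) :+ (w :- v) := z :- v) ≐-refl z w v)
    (≺-+ (e .close (ε ℚ.* ½) (half>0 ε>0)) (e′ .close (ε ℚ.* ½) (half>0 ε>0))))
  where open ℂ-Solver

≃-setoid : Setoid 0ℓ 0ℓ
≃-setoid = record
  { Carrier = ℂ ; _≈_ = _≃_
  ; isEquivalence = record { refl = ≃-refl ; sym = ≃-sym ; trans = ≃-trans } }

neg-cong : ∀ {z w} → z ≃ w → - z ≃ - w
neg-cong {z} {w} e .close ε ε>0 =
  ≺-resp-≐ (solve 2 (λ z w → :- (z :- w) := (:- z) :- (:- w)) ≐-refl z w) (≺-neg (e .close ε ε>0))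
  where open ℂ-Solver

+-cong : ∀ {z z′ w w′} → z ≃ z′ → w ≃ w′ → z + w ≃ z′ + w′
+-cong {z} {z′} {w} {w′} e e′ .close ε ε>0 = subst (z + w - (z′ + w′) ≺_) (half+half ε)
  (≺-resp-≐ (solve 4 (λ z z′ w w′ → (z :- z′) :+ (w :- w′) := (z :+ w) :- (z′ :+ w′)) ≐-refl z z′ w w′)
    (≺-+ (e .close (ε ℚ.* ½) (half>0 ε>0)) (e′ .close (ε ℚ.* ½) (half>0 ε>0))))
  where open ℂ-Solver

sub-cong : ∀ {z z′ w w′} → z ≃ z′ → w ≃ w′ → z - w ≃ z′ - w′
sub-cong e e′ = +-cong e (neg-cong e′)

*-congˡ : ∀ {z z′} w → z ≃ z′ → z * w ≃ z′ * w
*-congˡ {z} {z′} w e .close ε ε>0 with bounded w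
... | B , w≺B with divide ε (B ℚ.+ B) ε>0 (ℚ.+-mono-< (≺⇒>0 w≺B) (≺⇒>0 w≺B))
...   | δ , δ>0 , eq = subst (z * w - z′ * w ≺_) (trans (sym (ℚ.*-distribˡ-+ δ B B)) eq)
  (≺-resp-≐ (solve 3 (λ z z′ w → (z :- z′) :* w := z :* w :- z′ :* w) ≐-refl z z′ w)
    (≺-* (e .close δ δ>0) w≺B))
  where open ℂ-Solver

*-cong : ∀ {z z′ w w′} → z ≃ z′ → w ≃ w′ → z * w ≃ z′ * w′
*-cong {z} {z′} {w} {w′} e e′ = ≃-trans (*-congˡ w e)
  (≃-trans (≐⇒≃ (solve 2 (λ z w → z :* w := w :* z) ≐-refl z′ w))
    (≃-trans (*-congˡ z′ e′) (≐⇒≃ (solve 2 (λ z w → w :* z := z :* w) ≐-refl z′ w′))))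
  where open ℂ-Solver

*-congʳ : ∀ {w w′} z → w ≃ w′ → z * w ≃ z * w′
*-congʳ z = *-cong ≃-refl

-- Apartness from 0 and cancellation

norm² : ℂ → ℕ → ℚ
norm² z m = seq (re z) m ℚ.* seq (re z) m ℚ.+ seq (im z) m ℚ.* seq (im z) m

record NonZeroℂ (z : ℂ) : Set where
  constructor apart
  field
    gap      : ℚ
    gap>0    : 0ℚ ℚ.< gap
    start    : ℕ
    gap<norm : ∀ m → start ℕ.≤ m → gap ℚ.< norm² z m

∣-0∣² : ∀ z m → seq ∣ z - 0ℂ ∣² m ≡ norm² z m
∣-0∣² z m = solve 2 (λ a b → (a :- con 0ℚ) :* (a :- con 0ℚ) :+ (b :- con 0ℚ) :* (b :- con 0ℚ) :=
  a :* a :+ b :* b) refl (seq (re z) m) (seq (im z) m)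
  where open +-*-Solver

#⇒NonZero : ∀ {z} → z # 0ℂ → NonZeroℂ z
#⇒NonZero {z} (ε , ε>0 , N , h) = apart ε ε>0 N
  (λ m p → subst₂ ℚ._<_ (ℚ.+-identityˡ ε) (∣-0∣² z m) (h m p))

NonZero⇒# : ∀ {z} → NonZeroℂ z → z # 0ℂ
NonZero⇒# {z} (apart ε ε>0 N h) = ε , ε>0 , N ,
  (λ m p → subst₂ ℚ._<_ (sym (ℚ.+-identityˡ ε)) (sym (∣-0∣² z m)) (h m p))

-- With h = w - z = u + iv and z = a + ib, one has |z|² = |w|² - 2 (au + bv) - |h|². The last term
-- only helps, and the middle one is below 4Bδ in absolute value; δ is chosen to make this half of
-- the gap of z, and the other half remains for w.
NonZero-near : ∀ {z} → NonZeroℂ z → ∃[ δ ] (0ℚ ℚ.< δ × (∀ w → w - z ≺ δ → NonZeroℂ w))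
NonZero-near {z} (apart ε ε>0 N h) with bounded z
... | B , z≺B@(small M hr hi) with divide (ε ℚ.* ½) (B ℚ.+ B ℚ.+ (B ℚ.+ B)) (half>0 ε>0)
      (ℚ.+-mono-< (ℚ.+-mono-< (≺⇒>0 z≺B) (≺⇒>0 z≺B)) (ℚ.+-mono-< (≺⇒>0 z≺B) (≺⇒>0 z≺B)))
...   | δ , δ>0 , eq = δ , δ>0 , near
  where
  open ℚ.≤-Reasoning
  open +-*-Solver
  drop : ∀ a b c d → ε ℚ.< a ℚ.* a ℚ.+ b ℚ.* b →
         ∣ a ∣ ℚ.< B → ∣ b ∣ ℚ.< B → ∣ c ℚ.- a ∣ ℚ.< δ → ∣ d ℚ.- b ∣ ℚ.< δ →
         ε ℚ.* ½ ℚ.< c ℚ.* c ℚ.+ d ℚ.* d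
  drop a b c d ε< a< b< u< v< = begin-strict
    ε ℚ.* ½
      ≡⟨ solve 1 (λ e → e :* con ½ := e :- e :* con ½) refl ε ⟩
    ε ℚ.- ε ℚ.* ½
      <⟨ ℚ.+-monoˡ-< (ℚ.- (ε ℚ.* ½)) (begin-strict
           ε
             <⟨ ε< ⟩
           a ℚ.* a ℚ.+ b ℚ.* b
             ≡⟨ solve 4 (λ a b u v → a :* a :+ b :* b :=
                  (a :+ u) :* (a :+ u) :+ (b :+ v) :* (b :+ v) :+
                  :- ((a :* u :+ b :* v) :+ (a :* u :+ b :* v)) :- (u :* u :+ v :* v)) refl a b u v ⟩
           (a ℚ.+ u) ℚ.* (a ℚ.+ u) ℚ.+ (b ℚ.+ v) ℚ.* (b ℚ.+ v) ℚ.+ ℚ.- (x ℚ.+ x) ℚ.- (u ℚ.* u ℚ.+ v ℚ.* v)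
             ≤⟨ ℚ.+-mono-≤ (ℚ.+-mono-≤ (ℚ.≤-reflexive (cong₂ (λ c d → c ℚ.* c ℚ.+ d ℚ.* d) (cancel a c) (cancel b d)))
                  (ℚ.≤-trans (≤∣∣ (ℚ.- (x ℚ.+ x))) (ℚ.<⇒≤ (∣-∣< (x ℚ.+ x) (∣+∣< x x x< x<)))))
                  (ℚ.neg-antimono-≤ (ℚ.+-mono-≤ (sq≥0 u) (sq≥0 v))) ⟩
           c ℚ.* c ℚ.+ d ℚ.* d ℚ.+ ((B ℚ.* δ ℚ.+ B ℚ.* δ) ℚ.+ (B ℚ.* δ ℚ.+ B ℚ.* δ)) ℚ.+ 0ℚ
             ≡⟨ solve 3 (λ n B e → n :+ ((B :* e :+ B :* e) :+ (B :* e :+ B :* e)) :+ con 0ℚ :=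
                  n :+ e :* (B :+ B :+ (B :+ B))) refl (c ℚ.* c ℚ.+ d ℚ.* d) B δ ⟩
           c ℚ.* c ℚ.+ d ℚ.* d ℚ.+ δ ℚ.* (B ℚ.+ B ℚ.+ (B ℚ.+ B))
             ≡⟨ cong (c ℚ.* c ℚ.+ d ℚ.* d ℚ.+_) eq ⟩
           c ℚ.* c ℚ.+ d ℚ.* d ℚ.+ ε ℚ.* ½ ∎) ⟩
    c ℚ.* c ℚ.+ d ℚ.* d ℚ.+ ε ℚ.* ½ ℚ.- ε ℚ.* ½
      ≡⟨ solve 2 (λ n e → n :+ e :- e := n) refl (c ℚ.* c ℚ.+ d ℚ.* d) (ε ℚ.* ½) ⟩
    c ℚ.* c ℚ.+ d ℚ.* d ∎
    where
    u v x : ℚ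
    u = c ℚ.- a
    v = d ℚ.- b
    x = a ℚ.* u ℚ.+ b ℚ.* v
    x< : ∣ x ∣ ℚ.< B ℚ.* δ ℚ.+ B ℚ.* δ
    x< = ∣+∣< (a ℚ.* u) (b ℚ.* v) (∣*∣< a u a< u<) (∣*∣< b v b< v<)
    cancel : ∀ a c → a ℚ.+ (c ℚ.- a) ≡ c
    cancel = solve 2 (λ a c → a :+ (c :- a) := c) refl
  near : ∀ w → w - z ≺ δ → NonZeroℂ w
  near w (small K kr ki) = apart (ε ℚ.* ½) (half>0 ε>0) (N ℕ.⊔ (M ℕ.⊔ K)) λ m p →
    let MK≤m = ℕ.m⊔n≤o⇒n≤o N (M ℕ.⊔ K) p
        M≤m = ℕ.m⊔n≤o⇒m≤o M K MK≤m
        K≤m = ℕ.m⊔n≤o⇒n≤o M K MK≤m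
    in drop (seq (re z) m) (seq (im z) m) (seq (re w) m) (seq (im w) m)
         (h m (ℕ.m⊔n≤o⇒m≤o N (M ℕ.⊔ K) p)) (hr m M≤m) (hi m M≤m) (kr m K≤m) (ki m K≤m)

NonZero-resp-≃ : ∀ {z w} → z ≃ w → NonZeroℂ z → NonZeroℂ w
NonZero-resp-≃ {w = w} e nz with NonZero-near nz
... | δ , δ>0 , near = near w (≃-sym e .close δ δ>0)

norm²-* : ∀ z w m → norm² (z * w) m ≡ norm² z m ℚ.* norm² w m
norm²-* z w m = solve 4 (λ a b c d →
  (a :* c :- b :* d) :* (a :* c :- b :* d) :+ (a :* d :+ b :* c) :* (a :* d :+ b :* c) :=
  (a :* a :+ b :* b) :* (c :* c :+ d :* d)) refl
  (seq (re z) m) (seq (im z) m) (seq (re w) m) (seq (im w) m)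
  where open +-*-Solver

norm²≥0 : ∀ z m → 0ℚ ℚ.≤ norm² z m
norm²≥0 z m = ℚ.+-mono-≤ (sq≥0 (seq (re z) m)) (sq≥0 (seq (im z) m))

norm²< : ∀ {z B} (z≺B : z ≺ B) m → from z≺B ℕ.≤ m → norm² z m ℚ.< B ℚ.* B ℚ.+ B ℚ.* B
norm²< {z} {B} (small N h k) m p = ℚ.+-mono-<
  (subst (ℚ._< B ℚ.* B) (sq-∣∣ (seq (re z) m)) (sq< (h m p)))
  (subst (ℚ._< B ℚ.* B) (sq-∣∣ (seq (im z) m)) (sq< (k m p)))
  where
  sq< : ∀ {p} → ∣ p ∣ ℚ.< B → ∣ p ∣ ℚ.* ∣ p ∣ ℚ.< B ℚ.* B
  sq< {p} p<B = subst (ℚ._< B ℚ.* B) (ℚ.∣p*q∣≡∣p∣*∣q∣ p p) (∣*∣< p p p<B p<B)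

norm²<⇒≺ : ∀ z {ε} N → 0ℚ ℚ.< ε → (∀ m → N ℕ.≤ m → norm² z m ℚ.< ε ℚ.* ε) → z ≺ ε
norm²<⇒≺ z N ε>0 h = small N
  (λ m p → sq<sq⇒∣∣< (seq (re z) m) ε>0 (ℚ.≤-<-trans (subst (ℚ._≤ norm² z m) (ℚ.+-identityʳ _)
    (ℚ.+-monoʳ-≤ (seq (re z) m ℚ.* seq (re z) m) (sq≥0 (seq (im z) m)))) (h m p)))
  (λ m p → sq<sq⇒∣∣< (seq (im z) m) ε>0 (ℚ.≤-<-trans (subst (ℚ._≤ norm² z m) (ℚ.+-identityˡ _)
    (ℚ.+-monoˡ-≤ (seq (im z) m ℚ.* seq (im z) m) (sq≥0 (seq (re z) m)))) (h m p)))

-- By |zw|² = |z|² |w|² and |z|² < 2B², the gap of the product divided by 2B² is a gap for w.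
NonZero-*ʳ : ∀ z w → NonZeroℂ (z * w) → NonZeroℂ w
NonZero-*ʳ z w (apart ε ε>0 N h) with bounded z
... | B , z≺B = bound (divide ε A ε>0 A>0)
  where
  open ℚ.≤-Reasoning
  A : ℚ
  A = B ℚ.* B ℚ.+ B ℚ.* B
  A>0 : 0ℚ ℚ.< A
  A>0 = ℚ.+-mono-< (*>0 (≺⇒>0 z≺B) (≺⇒>0 z≺B)) (*>0 (≺⇒>0 z≺B) (≺⇒>0 z≺B))
  bound : ∃[ δ ] (0ℚ ℚ.< δ × δ ℚ.* A ≡ ε) → NonZeroℂ w
  bound (δ , δ>0 , eq) = apart δ δ>0 (N ℕ.⊔ from z≺B) λ m p →
    ℚ.*-cancelʳ-<-nonNeg A {{ℚ.nonNegative (ℚ.<⇒≤ A>0)}} (begin-strict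
      δ ℚ.* A                  ≡⟨ eq ⟩
      ε                        <⟨ h m (ℕ.m⊔n≤o⇒m≤o N (from z≺B) p) ⟩
      norm² (z * w) m          ≡⟨ norm²-* z w m ⟩
      norm² z m ℚ.* norm² w m  ≤⟨ ℚ.*-monoʳ-≤-nonNeg (norm² w m) {{ℚ.nonNegative (norm²≥0 w m)}}
                                    (ℚ.<⇒≤ (norm²< z≺B m (ℕ.m⊔n≤o⇒n≤o N (from z≺B) p))) ⟩
      A ℚ.* norm² w m          ≡⟨ ℚ.*-comm A (norm² w m) ⟩
      norm² w m ℚ.* A          ∎)

-- If δ is the gap of w and r bounds both parts of zw, then |z|² δ ≤ |zw|² < 2r² ≤ 2r ≤ ε² δ. The
-- step r² ≤ r uses r ≤ ½, and the last one is the choice of r by `shrink` with the constant `A` =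
-- 2.
*-cancelʳ-0 : ∀ {z w} → NonZeroℂ w → z * w ≃ 0ℂ → z ≃ 0ℂ
*-cancelʳ-0 {z} {w} (apart δ δ>0 N h) zw≃0 .close ε ε>0 = bound (shrink A (*>0 (*>0 ε>0 ε>0) δ>0) A>0)
  where
  A : ℚ
  A = 1ℚ ℚ.+ 1ℚ
  A>0 : 0ℚ ℚ.< A
  A>0 = ℚ.positive⁻¹ A
  zw≺ : ∀ {η} → 0ℚ ℚ.< η → z * w ≺ η
  zw≺ {η} η>0 = ≺-resp-≐ (solve 1 (λ x → x :- con 0ℚ := x) ≐-refl (z * w)) (zw≃0 .close η η>0)
    where open ℂ-Solver
  bound : ∃[ r ] (0ℚ ℚ.< r × r ℚ.≤ ½ × r ℚ.* A ℚ.≤ ε ℚ.* ε ℚ.* δ) → z - 0ℂ ≺ ε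
  bound (r , r>0 , r≤½ , rA≤) = ≺-resp-≐
    (solve 1 (λ x → x := x :- con 0ℚ) ≐-refl z) (norm²<⇒≺ z (N ℕ.⊔ from (zw≺ r>0)) ε>0 norm²z<)
    where
    open ℂ-Solver
    open ℚ.≤-Reasoning
    norm²z< : ∀ m → N ℕ.⊔ from (zw≺ r>0) ℕ.≤ m → norm² z m ℚ.< ε ℚ.* ε
    norm²z< m p = ℚ.*-cancelʳ-<-nonNeg δ {{ℚ.nonNegative (ℚ.<⇒≤ δ>0)}} (begin-strict
      norm² z m ℚ.* δ          ≤⟨ ℚ.*-monoˡ-≤-nonNeg (norm² z m) {{ℚ.nonNegative (norm²≥0 z m)}}
                                    (ℚ.<⇒≤ (h m (ℕ.m⊔n≤o⇒m≤o N _ p))) ⟩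
      norm² z m ℚ.* norm² w m  ≡⟨ norm²-* z w m ⟨
      norm² (z * w) m          <⟨ norm²< (zw≺ r>0) m (ℕ.m⊔n≤o⇒n≤o N _ p) ⟩
      r ℚ.* r ℚ.+ r ℚ.* r      ≤⟨ ℚ.+-mono-≤ r²≤r r²≤r ⟩
      r ℚ.+ r                  ≡⟨ double r ⟩
      r ℚ.* A                  ≤⟨ rA≤ ⟩
      ε ℚ.* ε ℚ.* δ            ∎)
      where
      double : ∀ r → r ℚ.+ r ≡ r ℚ.* (1ℚ ℚ.+ 1ℚ)
      double = S.solve 1 (λ r → r S.:+ r S.:= r S.:* S.con (1ℚ ℚ.+ 1ℚ)) refl
        where module S = +-*-Solver
      r²≤r : r ℚ.* r ℚ.≤ r
      r²≤r = subst (r ℚ.* r ℚ.≤_) (ℚ.*-identityʳ r) (ℚ.*-monoˡ-≤-nonNeg r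
        {{ℚ.nonNegative (ℚ.<⇒≤ r>0)}} (ℚ.≤-trans r≤½ (ℚ.≤ᵇ⇒≤ tt)))

*-cancelʳ : ∀ {z z′} w → NonZeroℂ w → z * w ≃ z′ * w → z ≃ z′
*-cancelʳ {z} {z′} w nz e = ≃-trans
  (≐⇒≃ (solve 2 (λ z z′ → z := (z :- z′) :+ z′) ≐-refl z z′))
  (≃-trans (+-cong (*-cancelʳ-0 nz (≃-trans
      (≐⇒≃ (solve 3 (λ z z′ w → (z :- z′) :* w := z :* w :- z′ :* w) ≐-refl z z′ w))
      (≃-trans (+-cong e ≃-refl) (≐⇒≃ (solve 1 (λ x → x :- x := con 0ℚ) ≐-refl (z′ * w))))))
    ≃-refl)
  (≐⇒≃ (solve 1 (λ z′ → con 0ℚ :+ z′ := z′) ≐-refl z′)))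
  where open ℂ-Solver

-- Series

module ≐-Reasoning = Relation.Binary.Reasoning.Setoid (CommutativeRing.setoid +-*-commutativeRing)
module ≃-Reasoning = Relation.Binary.Reasoning.Setoid ≃-setoid

sum<-cong : ∀ n {a b} → (∀ k → a k ≃ b k) → sum< n a ≃ sum< n b
sum<-cong zero    _ = ≃-refl
sum<-cong (suc n) p = +-cong (sum<-cong n p) (p n)

sum<-head : ∀ n a → sum< (suc n) a ≐ a 0 + sum< n (a ∘ suc)
sum<-head zero    a = solve 1 (λ x → con 0ℚ :+ x := x :+ con 0ℚ) ≐-refl (a 0)
  where open ℂ-Solver
sum<-head (suc n) a = ≐-trans (+-cong≐ (sum<-head n a) ≐-refl)
  (solve 3 (λ x y z → (x :+ y) :+ z := x :+ (y :+ z)) ≐-refl (a 0) (sum< n (a ∘ suc)) (a (suc n)))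
  where open ℂ-Solver

sum<-sub : ∀ n a b → sum< n (λ k → a k - b k) ≐ sum< n a - sum< n b
sum<-sub zero    a b = solve 0 (con 0ℚ := con 0ℚ :- con 0ℚ) ≐-refl
  where open ℂ-Solver
sum<-sub (suc n) a b = ≐-trans (+-cong≐ (sum<-sub n a b) ≐-refl)
  (solve 4 (λ x y z w → (x :- y) :+ (z :- w) := (x :+ z) :- (y :+ w)) ≐-refl
    (sum< n a) (sum< n b) (a n) (b n))
  where open ℂ-Solver

sum<-* : ∀ n c a → sum< n (λ k → c * a k) ≐ c * sum< n a
sum<-* zero    c a = solve 1 (λ c → con 0ℚ := c :* con 0ℚ) ≐-refl c
  where open ℂ-Solver
sum<-* (suc n) c a = ≐-trans (+-cong≐ (sum<-* n c a) ≐-refl)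
  (solve 3 (λ c x y → c :* x :+ c :* y := c :* (x :+ y)) ≐-refl c (sum< n a) (a n))
  where open ℂ-Solver

sum<-truncate : ∀ N {a} → (∀ n → N ℕ.≤ n → a n ≃ 0ℂ) → ∀ n → N ℕ.≤ n → sum< n a ≃ sum< N a
sum<-truncate N {a} vanish n N≤n = subst (λ n → sum< n a ≃ sum< N a) (ℕ.m∸n+n≡m N≤n) (go (n ℕ.∸ N))
  where
  open ℂ-Solver
  go : ∀ k → sum< (k ℕ.+ N) a ≃ sum< N a
  go zero    = ≃-refl
  go (suc k) = ≃-trans (+-cong (go k) (vanish (k ℕ.+ N) (ℕ.m≤n+m N k)))
    (≐⇒≃ (solve 1 (λ x → x :+ con 0ℚ := x) ≐-refl (sum< N a)))

record Sums (a : ℕ → ℂ) (s : ℂ) : Set where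
  constructor converges
  field
    limit : ∀ ε → 0ℚ ℚ.< ε → ∃[ N ] (∀ n → N ℕ.≤ n → sum< n a - s ≺ ε)

open Sums

∈Disk⇒≺ : ∀ {z ε} → 0ℚ ℚ.< ε → z ∈Disk ε → z ≺ ε
∈Disk⇒≺ {z} ε>0 (δ , δ>0 , N , h) = norm²<⇒≺ z N ε>0 λ m p →
  ℚ.<-trans (subst (ℚ._< norm² z m ℚ.+ δ) (ℚ.+-identityʳ (norm² z m))
    (ℚ.+-monoʳ-< (norm² z m) δ>0)) (h m p)

HasSum⇒Sums : ∀ {a s} → HasSum a s → Sums a s
HasSum⇒Sums h .limit ε ε>0 with h ε ε>0
... | N , k = N , λ n p → ∈Disk⇒≺ ε>0 (k n p)

Sums-cong : ∀ {a b s t} → (∀ n → a n ≃ b n) → s ≃ t → Sums a s → Sums b t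
Sums-cong {a} {b} {s} {t} p e h .limit ε ε>0 with h .limit (ε ℚ.* ½) (half>0 ε>0)
... | N , k = N , λ n N≤n → subst (sum< n b - t ≺_) (half+half ε)
  (≺-resp-≃ (sub-cong (sum<-cong n p) e) (half>0 ε>0) (k n N≤n))

Sums-unique : ∀ {a s t} → Sums a s → Sums a t → s ≃ t
Sums-unique {a} {s} {t} h h′ .close ε ε>0 with h .limit (ε ℚ.* ½) (half>0 ε>0) | h′ .limit (ε ℚ.* ½) (half>0 ε>0)
... | M , k | N , k′ = subst (s - t ≺_) (half+half ε)
  (≺-resp-≐ (solve 3 (λ x s t → (:- (x :- s)) :+ (x :- t) := s :- t) ≐-refl (sum< (M ℕ.⊔ N) a) s t)
    (≺-+ (≺-neg (k (M ℕ.⊔ N) (ℕ.m≤m⊔n M N))) (k′ (M ℕ.⊔ N) (ℕ.m≤n⊔m M N))))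
  where open ℂ-Solver

Sums-sub : ∀ {a b s t} → Sums a s → Sums b t → Sums (λ n → a n - b n) (s - t)
Sums-sub {a} {b} {s} {t} h h′ .limit ε ε>0 with h .limit (ε ℚ.* ½) (half>0 ε>0) | h′ .limit (ε ℚ.* ½) (half>0 ε>0)
... | M , k | N , k′ = M ℕ.⊔ N , λ n p → subst (sum< n (λ n → a n - b n) - (s - t) ≺_) (half+half ε)
  (≺-resp-≐ (≐-trans
      (solve 4 (λ x s y t → (x :- s) :+ (:- (y :- t)) := (x :- y) :- (s :- t)) ≐-refl (sum< n a) s (sum< n b) t)
      (+-cong≐ (≐-sym (sum<-sub n a b)) ≐-refl))
    (≺-+ (k n (ℕ.m⊔n≤o⇒m≤o M N p)) (≺-neg (k′ n (ℕ.m⊔n≤o⇒n≤o M N p)))))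
  where open ℂ-Solver

Sums-* : ∀ {a s} c → Sums a s → Sums (λ n → c * a n) (c * s)
Sums-* {a} {s} c h .limit ε ε>0 with bounded c
... | B , c≺B with divide ε (B ℚ.+ B) ε>0 (ℚ.+-mono-< (≺⇒>0 c≺B) (≺⇒>0 c≺B))
...   | δ , δ>0 , eq with h .limit δ δ>0
...     | N , k = N , λ n p → subst (sum< n (λ n → c * a n) - c * s ≺_)
  (trans (factor δ B) eq)
  (≺-resp-≐ (≐-trans
      (solve 3 (λ c x s → c :* (x :- s) := c :* x :- c :* s) ≐-refl c (sum< n a) s)
      (+-cong≐ (≐-sym (sum<-* n c a)) ≐-refl))
    (≺-* c≺B (k n p)))
  where
  open ℂ-Solver
  factor : ∀ δ B → B ℚ.* δ ℚ.+ B ℚ.* δ ≡ δ ℚ.* (B ℚ.+ B)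
  factor = S.solve 2 (λ δ B → B S.:* δ S.:+ B S.:* δ S.:= δ S.:* (B S.:+ B)) refl
    where module S = +-*-Solver

Sums-tail : ∀ {a s} → Sums a s → Sums (a ∘ suc) (s - a 0)
Sums-tail {a} {s} h .limit ε ε>0 with h .limit ε ε>0
... | N , k = N , λ n p → ≺-resp-≐ (≐-trans (+-cong≐ (sum<-head n a) ≐-refl)
    (solve 3 (λ a x s → (a :+ x) :- s := x :- (s :- a)) ≐-refl (a 0) (sum< n (a ∘ suc)) s))
  (k (suc n) (ℕ.m≤n⇒m≤1+n p))
  where open ℂ-Solver

Sums-finite : ∀ N {a} → (∀ n → N ℕ.≤ n → a n ≃ 0ℂ) → Sums a (sum< N a)
Sums-finite N vanish .limit ε ε>0 = N , λ n p → sum<-truncate N vanish n p .close ε ε>0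

-- A late term is the difference of two partial sums that are both within 1 of s, so 2 bounds it;
-- the finitely many earlier terms are bounded one by one.
terms-bounded : ∀ {a s} → Sums a s → ∃[ C ] (∀ n → a n ≺ C)
terms-bounded {a} {s} h with h .limit 1ℚ (ℚ.positive⁻¹ 1ℚ)
... | N , k = proj₁ (initial N) ℚ.+ 2ℚ , bound
  where
  open ℂ-Solver
  2ℚ : ℚ
  2ℚ = 1ℚ ℚ.+ 1ℚ
  weakenˡ : ∀ {z p q} → 0ℚ ℚ.≤ q → z ≺ p → z ≺ p ℚ.+ q
  weakenˡ {p = p} {q} q≥0 = ≺-mono (subst (ℚ._≤ p ℚ.+ q) (ℚ.+-identityʳ p) (ℚ.+-monoʳ-≤ p q≥0))
  weakenʳ : ∀ {z p q} → 0ℚ ℚ.≤ p → z ≺ q → z ≺ p ℚ.+ q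
  weakenʳ {p = p} {q} p≥0 = ≺-mono (subst (ℚ._≤ p ℚ.+ q) (ℚ.+-identityˡ q) (ℚ.+-monoˡ-≤ q p≥0))
  initial : ∀ N → ∃[ B ] (0ℚ ℚ.≤ B × (∀ n → n ℕ.< N → a n ≺ B))
  initial zero    = 0ℚ , ℚ.≤-refl , λ _ ()
  initial (suc N) with initial N | bounded (a N)
  ... | B , B≥0 , hB | C , aN≺C = B ℚ.+ C , ℚ.+-mono-≤ B≥0 (ℚ.<⇒≤ (≺⇒>0 aN≺C)) , bound′
    where
    bound′ : ∀ n → n ℕ.< suc N → a n ≺ B ℚ.+ C
    bound′ n p with ℕ.m≤n⇒m<n∨m≡n (ℕ.s≤s⁻¹ p)
    ... | inj₁ n<N  = weakenˡ (ℚ.<⇒≤ (≺⇒>0 aN≺C)) (hB n n<N)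
    ... | inj₂ refl = weakenʳ B≥0 aN≺C
  bound : ∀ n → a n ≺ proj₁ (initial N) ℚ.+ 2ℚ
  bound n with ℕ.<-≤-connex n N
  ... | inj₁ n<N = weakenˡ (ℚ.≤ᵇ⇒≤ tt) (proj₂ (proj₂ (initial N)) n n<N)
  ... | inj₂ N≤n = weakenʳ (proj₁ (proj₂ (initial N)))
    (≺-resp-≐ (solve 3 (λ x a s → (x :+ a :- s) :+ (:- (x :- s)) := a) ≐-refl (sum< n a) (a n) s)
      (≺-+ (k (suc n) (ℕ.m≤n⇒m≤1+n N≤n)) (≺-neg (k n N≤n))))

-- Power series at small positive rationals and the identity theorem

min : ∀ p q → 0ℚ ℚ.< p → 0ℚ ℚ.< q → ∃[ r ] (0ℚ ℚ.< r × r ℚ.≤ p × r ℚ.≤ q)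
min p q p>0 q>0 with ℚ.≤-total p q
... | inj₁ p≤q = p , p>0 , ℚ.≤-refl , p≤q
... | inj₂ q≤p = q , q>0 , q≤p , ℚ.≤-refl

-- The interval is closed at ρ, so that ρ itself is available as a sample point.
Near0⁺ : (ℚ → Set) → Set
Near0⁺ Q = ∃[ ρ ] (0ℚ ℚ.< ρ × (∀ q → 0ℚ ℚ.< q → q ℚ.≤ ρ → Q q))

Near0⁺-map : ∀ {Q R : ℚ → Set} → (∀ q → 0ℚ ℚ.< q → Q q → R q) → Near0⁺ Q → Near0⁺ R
Near0⁺-map g (ρ , ρ>0 , h) = ρ , ρ>0 , λ q q>0 q≤ρ → g q q>0 (h q q>0 q≤ρ)

Near0⁺-× : ∀ {Q R : ℚ → Set} → Near0⁺ Q → Near0⁺ R → Near0⁺ (λ q → Q q × R q)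
Near0⁺-× {Q} {R} (ρ , ρ>0 , h) (σ , σ>0 , k) = choose (min ρ σ ρ>0 σ>0)
  where
  choose : ∃[ τ ] (0ℚ ℚ.< τ × τ ℚ.≤ ρ × τ ℚ.≤ σ) → Near0⁺ (λ q → Q q × R q)
  choose (τ , τ>0 , τ≤ρ , τ≤σ) = τ , τ>0 , λ q q>0 q≤τ →
    h q q>0 (ℚ.≤-trans q≤τ τ≤ρ) , k q q>0 (ℚ.≤-trans q≤τ τ≤σ)

Near0⁺-point : ∀ {Q : ℚ → Set} → Near0⁺ Q → ∃[ q ] (0ℚ ℚ.< q × Q q)
Near0⁺-point (ρ , ρ>0 , h) = ρ , ρ>0 , h ρ ρ>0 ℚ.≤-refl

PowerSeries : (a : ℕ → ℂ) (z s : ℂ) → Set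
PowerSeries a z s = Sums (λ n → a n * z ^ n) s

PowerSeries-tail : ∀ {a s} z z⁻¹ → z⁻¹ * z ≐ 1ℂ →
                   PowerSeries a z s → PowerSeries (a ∘ suc) z (z⁻¹ * (s - a 0))
PowerSeries-tail {a} {s} z z⁻¹ inv h = Sums-cong
  (λ n → ≐⇒≃ (≐-trans
    (solve 4 (λ y a z p → y :* (a :* (z :* p)) := (y :* z) :* (a :* p)) ≐-refl z⁻¹ (a (suc n)) z (z ^ n))
    (≐-trans (*-cong≐ inv ≐-refl)
      (solve 1 (λ x → con 1ℚ :* x := x) ≐-refl (a (suc n) * z ^ n)))))
  (≐⇒≃ (solve 3 (λ y s a → y :* (s :- a :* con 1ℚ) := y :* (s :- a)) ≐-refl z⁻¹ s (a 0)))
  (Sums-* z⁻¹ (Sums-tail h))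
  where open ℂ-Solver

powerSum-head : ∀ n (a : ℕ → ℂ) z → sum< (suc n) (λ k → a k * z ^ k) ≐ a 0 + z * sum< n (λ k → a (suc k) * z ^ k)
powerSum-head n a z = begin
  sum< (suc n) (λ k → a k * z ^ k)                   ≈⟨ sum<-head n (λ k → a k * z ^ k) ⟩
  a 0 * 1ℂ + sum< n (λ k → a (suc k) * (z * z ^ k))  ≈⟨ +-cong≐ head tail ⟩
  a 0 + sum< n (λ k → z * (a (suc k) * z ^ k))       ≈⟨ +-cong≐ ≐-refl (sum<-* n z (λ k → a (suc k) * z ^ k)) ⟩
  a 0 + z * sum< n (λ k → a (suc k) * z ^ k)         ∎
  where
  open ≐-Reasoning
  open ℂ-Solver using (solve; _:*_; _:=_; con)
  head : a 0 * 1ℂ ≐ a 0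
  head = solve 1 (λ a → a :* con 1ℚ := a) ≐-refl (a 0)
  tail : sum< n (λ k → a (suc k) * (z * z ^ k)) ≐ sum< n (λ k → z * (a (suc k) * z ^ k))
  tail = sum<-cong≐ n λ k →
    solve 3 (λ a z p → a :* (z :* p) := z :* (a :* p)) ≐-refl (a (suc k)) z (z ^ k)

PowerSeries-at-0 : ∀ (a : ℕ → ℂ) {s} → PowerSeries a 0ℂ s → s ≃ a 0
PowerSeries-at-0 a h = ≃-trans (Sums-unique h (Sums-finite 1 vanish))
  (≐⇒≃ (solve 1 (λ a → con 0ℚ :+ a :* con 1ℚ := a) ≐-refl (a 0)))
  where
  open ℂ-Solver
  vanish : ∀ n → 1 ℕ.≤ n → a n * 0ℂ ^ n ≃ 0ℂ
  vanish (suc n) _ = ≐⇒≃ (solve 2 (λ a p → a :* (con 0ℚ :* p) := con 0ℚ) ≐-refl (a (suc n)) (0ℂ ^ n))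

-- Horner's rule: b₀ + r T ≺ C + ½ · 2C.
partial-bound : ∀ {C r} → 0ℚ ℚ.< r → r ℚ.≤ ½ → ∀ n (b : ℕ → ℂ) → (∀ k → b k ≺ C) →
                sum< n (λ k → b k * fromℚ r ^ k) ≺ C ℚ.+ C
partial-bound r>0 r≤½ zero    b hb = 0≺ (ℚ.+-mono-< (≺⇒>0 (hb 0)) (≺⇒>0 (hb 0)))
partial-bound {C} {r} r>0 r≤½ (suc n) b hb =
  ≺-mono (ℚ.+-monoʳ-≤ C (begin
    r ℚ.* (C ℚ.+ C) ≤⟨ ℚ.*-monoʳ-≤-nonNeg (C ℚ.+ C) {{ℚ.nonNegative (ℚ.<⇒≤ (ℚ.+-mono-< C>0 C>0))}} r≤½ ⟩
    ½ ℚ.* (C ℚ.+ C) ≡⟨ solve 1 (λ C → con ½ :* (C :+ C) := C) refl C ⟩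
    C               ∎))
  (≺-resp-≐ (≐-sym (powerSum-head n b (fromℚ r)))
    (≺-+ (hb 0) (≺-scale r r>0 (partial-bound r>0 r≤½ n (b ∘ suc) (hb ∘ suc)))))
  where
  open ℚ.≤-Reasoning
  open +-*-Solver
  C>0 : 0ℚ ℚ.< C
  C>0 = ≺⇒>0 (hb 0)

-- A partial sum minus its head is r times a partial sum of the shifted series, which
-- `partial-bound` keeps below 2C. The truncation error is allowed to be r C, whence the third C.
sum-near-head : ∀ {C r s} (b : ℕ → ℂ) → 0ℚ ℚ.< r → r ℚ.≤ ½ → (∀ k → b k ≺ C) →
                PowerSeries b (fromℚ r) s → s - b 0 ≺ r ℚ.* (C ℚ.+ C ℚ.+ C)
sum-near-head {C} {r} {s} b r>0 r≤½ hb h with h .limit (r ℚ.* C) (*>0 r>0 (≺⇒>0 (hb 0)))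
... | N , k = subst (s - b 0 ≺_) (sym (ℚ.*-distribˡ-+ r (C ℚ.+ C) C))
  (≺-resp-≐ rearranged
    (≺-+ (≺-scale r r>0 (partial-bound r>0 r≤½ N (b ∘ suc) (hb ∘ suc)))
      (≺-neg (k (suc N) (ℕ.n≤1+n N)))))
  where
  open ℂ-Solver
  T : ℂ
  T = fromℚ r * sum< N (λ k → b (suc k) * fromℚ r ^ k)
  rearranged : T - (sum< (suc N) (λ k → b k * fromℚ r ^ k) - s) ≐ s - b 0
  rearranged = ≐-trans
    (+-cong≐ (≐-refl {T}) (neg-cong≐ (+-cong≐ (powerSum-head N b (fromℚ r)) (≐-refl { - s}))))
    (solve 3 (λ x b s → x :- ((b :+ x) :- s) := s :- b) ≐-refl T (b 0) s)

-- Convergence at the single point ρ bounds all terms a_n ρⁿ by one constant C. For q = xρ the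
-- series is one in x with these terms as coefficients, and for x ≤ ½ it is dominated by a geometric
-- series, so it differs from its head by at most 3Cx.
PowerSeries-continuous : ∀ {a s₀ ρ} → 0ℚ ℚ.< ρ → PowerSeries a (fromℚ ρ) s₀ → ∀ ε → 0ℚ ℚ.< ε →
  Near0⁺ (λ q → ∀ s → PowerSeries a (fromℚ q) s → s - a 0 ≺ ε)
PowerSeries-continuous {a} {s₀} {ρ} ρ>0 h₀ ε ε>0 with terms-bounded h₀
... | C , hC = choose (shrink 3C ε>0 3C>0)
  where
  open ℂ-Solver
  3C : ℚ
  3C = C ℚ.+ C ℚ.+ C
  3C>0 : 0ℚ ℚ.< 3C
  3C>0 = ℚ.+-mono-< (ℚ.+-mono-< (≺⇒>0 (hC 0)) (≺⇒>0 (hC 0))) (≺⇒>0 (hC 0))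
  choose : ∃[ r ] (0ℚ ℚ.< r × r ℚ.≤ ½ × r ℚ.* 3C ℚ.≤ ε) →
    Near0⁺ (λ q → ∀ s → PowerSeries a (fromℚ q) s → s - a 0 ≺ ε)
  choose (r , r>0 , r≤½ , r3C≤ε) = r ℚ.* ρ , *>0 r>0 ρ>0 , near
    where
    near : ∀ q → 0ℚ ℚ.< q → q ℚ.≤ r ℚ.* ρ → ∀ s → PowerSeries a (fromℚ q) s → s - a 0 ≺ ε
    near q q>0 q≤rρ s h with divide q ρ q>0 ρ>0
    ... | x , x>0 , refl = ≺-mono (ℚ.≤-trans
          (ℚ.*-monoʳ-≤-nonNeg 3C {{ℚ.nonNegative (ℚ.<⇒≤ 3C>0)}} x≤r) r3C≤ε)
        (≺-resp-≐ (solve 2 (λ s a → s :- a :* con 1ℚ := s :- a) ≐-refl s (a 0))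
          (sum-near-head (λ n → a n * fromℚ ρ ^ n) x>0 (ℚ.≤-trans x≤r r≤½) hC
            (Sums-cong (λ n → ≐⇒≃ (rescale n)) ≃-refl h)))
      where
      x≤r : x ℚ.≤ r
      x≤r = ℚ.*-cancelʳ-≤-pos ρ {{ℚ.positive ρ>0}} q≤rρ
      rescale : ∀ n → a n * fromℚ (x ℚ.* ρ) ^ n ≐ (a n * fromℚ ρ ^ n) * fromℚ x ^ n
      rescale n = ≐-trans (*-cong≐ ≐-refl (≐-trans (^-cong≐ n (fromℚ-* x ρ)) (^-distrib-* (fromℚ x) (fromℚ ρ) n)))
        (solve 3 (λ a x r → a :* (x :* r) := (a :* r) :* x) ≐-refl (a n) (fromℚ x ^ n) (fromℚ ρ ^ n))

-- The sums, all 0, tend to the constant term, so that vanishes. Division by q > 0 then turns the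
-- tail into another series with sum 0 near 0, to which the induction applies.
PowerSeries-zero : ∀ {a} → Near0⁺ (λ q → PowerSeries a (fromℚ q) 0ℂ) → ∀ n → a n ≃ 0ℂ
PowerSeries-zero {a} h@(ρ , ρ>0 , hρ) zero = ≃-sym λ where
    .close ε ε>0 → near ε (Near0⁺-point (Near0⁺-×
      (PowerSeries-continuous {a} ρ>0 (hρ ρ ρ>0 ℚ.≤-refl) ε ε>0) h))
  where
  near : ∀ ε → ∃[ q ] (0ℚ ℚ.< q × ((∀ s → PowerSeries a (fromℚ q) s → s - a 0 ≺ ε) ×
                                    PowerSeries a (fromℚ q) 0ℂ)) → 0ℂ - a 0 ≺ ε
  near ε (q , q>0 , k , hq) = k 0ℂ hq
PowerSeries-zero {a} h (suc n) = PowerSeries-zero {a ∘ suc} (Near0⁺-map tail h) n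
  where
  open ℂ-Solver
  tail : ∀ q → 0ℚ ℚ.< q → PowerSeries a (fromℚ q) 0ℂ → PowerSeries (a ∘ suc) (fromℚ q) 0ℂ
  tail q q>0 hq with divide 1ℚ q (ℚ.positive⁻¹ 1ℚ) q>0
  ... | y , _ , yq≡1 = Sums-cong (λ _ → ≃-refl)
    (≃-trans (*-congʳ (fromℚ y) (sub-cong ≃-refl (PowerSeries-zero {a} h zero)))
      (≐⇒≃ (solve 1 (λ y → y :* (con 0ℚ :- con 0ℚ) := con 0ℚ) ≐-refl (fromℚ y))))
    (PowerSeries-tail {a} (fromℚ q) (fromℚ y)
      (fromℚ-inverse y q yq≡1) hq)

PowerSeries-unique : ∀ {a b} →
  Near0⁺ (λ q → ∃[ s ] (PowerSeries a (fromℚ q) s × PowerSeries b (fromℚ q) s)) → ∀ n → a n ≃ b n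
PowerSeries-unique {a} {b} h n = ≃-trans
  (≐⇒≃ (solve 2 (λ x y → x := (x :- y) :+ y) ≐-refl (a n) (b n)))
  (≃-trans (+-cong (PowerSeries-zero {λ n → a n - b n} (Near0⁺-map (λ q _ → difference q) h) n) ≃-refl)
    (≐⇒≃ (solve 1 (λ y → con 0ℚ :+ y := y) ≐-refl (b n))))
  where
  open ℂ-Solver
  difference : ∀ q → ∃[ s ] (PowerSeries a (fromℚ q) s × PowerSeries b (fromℚ q) s) →
               PowerSeries (λ n → a n - b n) (fromℚ q) 0ℂ
  difference q (s , ha , hb) = Sums-cong
    (λ n → ≐⇒≃ (solve 3 (λ x y p → x :* p :- y :* p := (x :- y) :* p) ≐-refl (a n) (b n) (fromℚ q ^ n)))
    (≐⇒≃ (solve 1 (λ s → s :- s := con 0ℚ) ≐-refl s))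
    (Sums-sub ha hb)

-- The exponential series at rational points

1/! : ℕ → ℂ
1/! n = fromℚ (1/ n !)

-- At a rational point every partial sum has a constant approximating
-- sequence, so the diagonal in the definition of exp is the sequence of partial sums.
exp-rational : ∀ q → PowerSeries 1/! (fromℚ q) (exp (fromℚ q))
exp-rational q = Sums-cong
  (λ k → ≐⇒≃ (solve 2 (λ p c → p :* c := c :* p) ≐-refl (fromℚ q ^ k) (1/! k))) ≃-refl
  partialSums
  where
  open ℂ-Solver
  record Constant (z : ℂ) : Set where
    field
      re-const : ∀ m n → seq (re z) m ≡ seq (re z) n
      im-const : ∀ m n → seq (im z) m ≡ seq (im z) n
  open Constant
  const-+ : ∀ {z w} → Constant z → Constant w → Constant (z + w)
  const-+ h k .re-const m n = cong₂ ℚ._+_ (h .re-const m n) (k .re-const m n)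
  const-+ h k .im-const m n = cong₂ ℚ._+_ (h .im-const m n) (k .im-const m n)
  const-* : ∀ {z w} → Constant z → Constant w → Constant (z * w)
  const-* h k .re-const m n = cong₂ ℚ._-_
    (cong₂ ℚ._*_ (h .re-const m n) (k .re-const m n)) (cong₂ ℚ._*_ (h .im-const m n) (k .im-const m n))
  const-* h k .im-const m n = cong₂ ℚ._+_
    (cong₂ ℚ._*_ (h .re-const m n) (k .im-const m n)) (cong₂ ℚ._*_ (h .im-const m n) (k .re-const m n))
  const-ℚ : ∀ p → Constant (fromℚ p)
  const-ℚ p .re-const _ _ = refl
  const-ℚ p .im-const _ _ = refl
  const-^ : ∀ k → Constant (fromℚ q ^ k)
  const-^ zero    = const-ℚ 1ℚ
  const-^ (suc k) = const-* (const-ℚ q) (const-^ k)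
  const-exp : ∀ n → Constant (expSum (fromℚ q) n)
  const-exp zero    = const-ℚ 0ℚ
  const-exp (suc n) = const-+ (const-exp n) (const-* (const-^ n) (const-ℚ (1/ n !)))
  partialSums : Sums (λ k → fromℚ q ^ k * 1/! k) (exp (fromℚ q))
  -- The approximations of `exp (fromℚ q)` are the partial sums themselves, so the Cauchy modulus of
  -- `exp` doubles as a rate of convergence.
  partialSums .limit ε ε>0 = M ℕ.⊔ N , λ n p → small (M ℕ.⊔ N)
    (λ m p′ → shift (const-exp n .re-const n m) (proj₂ re-cauchy n m (ℕ.m⊔n≤o⇒m≤o M N p) (ℕ.m⊔n≤o⇒m≤o M N p′)))
    (λ m p′ → shift (const-exp n .im-const n m) (proj₂ im-cauchy n m (ℕ.m⊔n≤o⇒n≤o M N p) (ℕ.m⊔n≤o⇒n≤o M N p′)))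
    where
    re-cauchy = exp-re-cauchy (fromℚ q) ε ε>0
    im-cauchy = exp-im-cauchy (fromℚ q) ε ε>0
    M N : ℕ
    M = proj₁ re-cauchy
    N = proj₁ im-cauchy
    shift : ∀ {x y z} → x ≡ y → ∣ x ℚ.- z ∣ ℚ.< ε → ∣ y ℚ.- z ∣ ℚ.< ε
    shift refl x< = x<

exp-0 : exp 0ℂ ≃ 1ℂ
exp-0 = PowerSeries-at-0 1/! (exp-rational 0ℚ)

-- Neighbourhoods of 0 and generating functions

-- With errors below η in both factors, zw - z′w′ is at most 2η² + 2ηB + 2ηA = η (2η + 2A + 2B).
limit-product : ∀ {z w v} →
  (∀ ε → 0ℚ ℚ.< ε → ∃[ z′ ] ∃[ w′ ] (z′ - z ≺ ε × w′ - w ≺ ε × z′ * w′ ≃ v)) → z * w ≃ v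
limit-product {z} {w} {v} approx .close ε ε>0 =
  choose (bounded z) (bounded w)
  where
  module S = +-*-Solver
  open ℂ-Solver
  open ℚ.≤-Reasoning
  choose : ∃[ A ] z ≺ A → ∃[ B ] w ≺ B → z * w - v ≺ ε
  choose (A , z≺A) (B , w≺B) = estimate (shrink C (half>0 ε>0) C>0)
    where
    C : ℚ
    -- The summand 1 absorbs 2η, as η ≤ ½.
    C = 1ℚ ℚ.+ (A ℚ.+ A ℚ.+ (B ℚ.+ B))
    C>0 : 0ℚ ℚ.< C
    C>0 = ℚ.+-mono-< (ℚ.positive⁻¹ 1ℚ)
      (ℚ.+-mono-< (ℚ.+-mono-< (≺⇒>0 z≺A) (≺⇒>0 z≺A)) (ℚ.+-mono-< (≺⇒>0 w≺B) (≺⇒>0 w≺B)))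
    estimate : ∃[ η ] (0ℚ ℚ.< η × η ℚ.≤ ½ × η ℚ.* C ℚ.≤ ε ℚ.* ½) → z * w - v ≺ ε
    estimate (η , η>0 , η≤½ , ηC≤) = near (approx η η>0)
      where
      total : ℚ
      total = (η ℚ.* η ℚ.+ η ℚ.* η) ℚ.+ (η ℚ.* B ℚ.+ η ℚ.* B) ℚ.+ (A ℚ.* η ℚ.+ A ℚ.* η)
      total≤ : total ℚ.≤ ε ℚ.* ½
      total≤ = begin
        total
          ≡⟨ S.solve 3 (λ η A B →
               (η S.:* η S.:+ η S.:* η) S.:+ (η S.:* B S.:+ η S.:* B) S.:+ (A S.:* η S.:+ A S.:* η) S.:=
               η S.:* ((η S.:+ η) S.:+ (A S.:+ A S.:+ (B S.:+ B)))) refl η A B ⟩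
        η ℚ.* ((η ℚ.+ η) ℚ.+ (A ℚ.+ A ℚ.+ (B ℚ.+ B)))
          ≤⟨ ℚ.*-monoˡ-≤-nonNeg η {{ℚ.nonNegative (ℚ.<⇒≤ η>0)}}
               (ℚ.+-monoˡ-≤ (A ℚ.+ A ℚ.+ (B ℚ.+ B)) (ℚ.+-mono-≤ η≤½ η≤½)) ⟩
        η ℚ.* C ≤⟨ ηC≤ ⟩
        ε ℚ.* ½ ∎
      near : ∃[ z′ ] ∃[ w′ ] (z′ - z ≺ η × w′ - w ≺ η × z′ * w′ ≃ v) → z * w - v ≺ ε
      near (z′ , w′ , hz , hw , e) = subst (z * w - v ≺_) (half+half ε)
        (≺-resp-≃ {z = z * w - z′ * w′} (sub-cong ≃-refl e) (half>0 ε>0) (≺-mono total≤ (≺-resp-≐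
          (solve 4 (λ z w z′ w′ →
            :- ((z′ :- z) :* (w′ :- w) :+ (z′ :- z) :* w :+ z :* (w′ :- w)) := z :* w :- z′ :* w′)
            ≐-refl z w z′ w′)
          (≺-neg (≺-+ (≺-+ (≺-* hz hw) (≺-* hz w≺B)) (≺-* z≺A hw))))))

fromℚ∈Disk : ∀ {q ρ} → 0ℚ ℚ.< q → q ℚ.< ρ → fromℚ q ∈Disk ρ
-- `_<ᴿ_` asks that the inequality stay strict after adding the gap, so only half of the difference
-- of the squares is used.
fromℚ∈Disk {q} {ρ} q>0 q<ρ = d ℚ.* ½ , half>0 d>0 , 0 , λ _ _ → begin-strict
    q ℚ.* q ℚ.+ 0ℚ ℚ.* 0ℚ ℚ.+ d ℚ.* ½
      ≡⟨ solve 2 (λ a b → a :+ con 0ℚ :* con 0ℚ :+ (b :- a) :* con ½ := b :- (b :- a) :* con ½) refl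
           (q ℚ.* q) (ρ ℚ.* ρ) ⟩
    ρ ℚ.* ρ ℚ.- d ℚ.* ½
      <⟨ ℚ.+-monoʳ-< (ρ ℚ.* ρ) (ℚ.neg-antimono-< (half>0 d>0)) ⟩
    ρ ℚ.* ρ ℚ.+ 0ℚ
      ≡⟨ ℚ.+-identityʳ (ρ ℚ.* ρ) ⟩
    ρ ℚ.* ρ ∎
  where
  open ℚ.≤-Reasoning
  open +-*-Solver
  d : ℚ
  d = ρ ℚ.* ρ ℚ.- q ℚ.* q
  q²<ρ² : q ℚ.* q ℚ.< ρ ℚ.* ρ
  q²<ρ² = ℚ.<-trans (ℚ.*-monoʳ-<-pos q {{ℚ.positive q>0}} q<ρ)
    (ℚ.*-monoˡ-<-pos ρ {{ℚ.positive (ℚ.<-trans q>0 q<ρ)}} q<ρ)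
  d>0 : 0ℚ ℚ.< d
  d>0 = subst (ℚ._< d) (ℚ.+-inverseʳ (q ℚ.* q)) (ℚ.+-monoˡ-< (ℚ.- (q ℚ.* q)) q²<ρ²)

norm²-neg : ∀ z m → norm² (- z) m ≡ norm² z m
norm²-neg z m = solve 2 (λ a b → (:- a) :* (:- a) :+ (:- b) :* (:- b) := a :* a :+ b :* b) refl
  (seq (re z) m) (seq (im z) m)
  where open +-*-Solver

neg∈Disk : ∀ z ρ → z ∈Disk ρ → (- z) ∈Disk ρ
neg∈Disk z ρ (ε , ε>0 , N , h) = ε , ε>0 , N , λ m p →
  subst (λ x → x ℚ.+ ε ℚ.< ρ ℚ.* ρ) (sym (norm²-neg z m)) (h m p)

∈Disk-mono : ∀ z {ρ ρ′} → 0ℚ ℚ.< ρ → ρ ℚ.≤ ρ′ → z ∈Disk ρ → z ∈Disk ρ′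
∈Disk-mono z ρ>0 ρ≤ρ′ (ε , ε>0 , N , h) = ε , ε>0 , N , λ m p →
  ℚ.<-≤-trans (h m p) (*-mono-≤₀ (ℚ.<⇒≤ ρ>0) (ℚ.<⇒≤ (ℚ.<-≤-trans ρ>0 ρ≤ρ′)) ρ≤ρ′ ρ≤ρ′)

NonZero-fromℚ : ∀ {q} → 0ℚ ℚ.< q → NonZeroℂ (fromℚ q)
NonZero-fromℚ {q} q>0 = apart (q ℚ.* q ℚ.* ½) (half>0 (*>0 q>0 q>0)) 0 λ _ _ → begin-strict
    q ℚ.* q ℚ.* ½                     ≡⟨ ℚ.+-identityʳ _ ⟨
    q ℚ.* q ℚ.* ½ ℚ.+ 0ℚ              <⟨ ℚ.+-monoʳ-< (q ℚ.* q ℚ.* ½) (half>0 (*>0 q>0 q>0)) ⟩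
    q ℚ.* q ℚ.* ½ ℚ.+ q ℚ.* q ℚ.* ½   ≡⟨ half+half (q ℚ.* q) ⟩
    q ℚ.* q                           ≡⟨ ℚ.+-identityʳ _ ⟨
    q ℚ.* q ℚ.+ 0ℚ ℚ.* 0ℚ             ∎
  where open ℚ.≤-Reasoning

NonZero-neg : ∀ {z} → NonZeroℂ z → NonZeroℂ (- z)
NonZero-neg {z} (apart ε ε>0 N h) = apart ε ε>0 N
  (λ m p → subst (ε ℚ.<_) (sym (norm²-neg z m)) (h m p))

neg-^ : ∀ z n → (- z) ^ n ≐ (- 1ℂ) ^ n * z ^ n
neg-^ z n = ≐-trans (^-cong≐ n (solve 1 (λ z → :- z := (:- con 1ℚ) :* z) ≐-refl z))
  (^-distrib-* (- 1ℂ) z n)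
  where open ℂ-Solver

exp-0* : ∀ z → exp (0ℂ * z) ≃ 1ℂ
exp-0* z = ≃-trans (≐⇒≃ (exp-cong≐ {0ℂ * z} {0ℂ} (solve 1 (λ z → con 0ℚ :* z := con 0ℚ) ≐-refl z))) exp-0
  where open ℂ-Solver

*-exp-0* : ∀ z t → z * exp (0ℂ * t) ≃ z
*-exp-0* z t = ≃-trans (*-congʳ z (exp-0* t)) (≐⇒≃ (solve 1 (λ z → z :* con 1ℚ := z) ≐-refl z))
  where open ℂ-Solver

exp-1* : ∀ z → exp ((1ℂ - 0ℂ) * z) ≃ exp z
exp-1* z = ≐⇒≃ (exp-cong≐ {(1ℂ - 0ℂ) * z} {z} (solve 1 (λ z → (con 1ℚ :- con 0ℚ) :* z := z) ≐-refl z))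
  where open ℂ-Solver

coefficient : (ℕ → Poly) → ℂ → ℕ → ℂ
coefficient P x n = eval (P n) x * 1/! n

EGF⇒PowerSeries : ∀ P x t {s s′} → s ≃ s′ → EGF P x t s → PowerSeries (coefficient P x) t s′
EGF⇒PowerSeries P x t e h = Sums-cong
  (λ n → ≐⇒≃ (solve 3 (λ p t c → p :* (t :* c) := (p :* c) :* t) ≐-refl (eval (P n) x) (t ^ n) (1/! n)))
  e (HasSum⇒Sums h)
  where open ℂ-Solver

-- Moving the sign into the coefficients makes the series at -t a series in t, comparable with the
-- one at t.
EGF-neg⇒PowerSeries : ∀ P x t {s s′} → s ≃ s′ → EGF P x (- t) s →
                      PowerSeries (λ n → (- 1ℂ) ^ n * coefficient P x n) t s′
EGF-neg⇒PowerSeries P x t e h = Sums-cong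
  (λ n → ≐⇒≃ (≐-trans (*-cong≐ ≐-refl (*-cong≐ (neg-^ t n) ≐-refl))
    (solve 4 (λ p m t c → p :* ((m :* t) :* c) := (m :* (p :* c)) :* t) ≐-refl
      (eval (P n) x) ((- 1ℂ) ^ n) (t ^ n) (1/! n))))
  e (HasSum⇒Sums h)
  where open ℂ-Solver

coefficient-injective : ∀ P Q x → (∀ n → coefficient P x n ≃ coefficient Q x n) →
                        ∀ n → eval (P n) x ≃ eval (Q n) x
coefficient-injective P Q x e n =
  *-cancelʳ (1/! n) (NonZero-fromℚ (1/>0 (n !) {{n ℕ.!≢0}})) (e n)

-- The coefficients of t as a power series in t.
δ₁ : ℕ → ℂ
δ₁ 1 = 1ℂ
δ₁ _ = 0ℂ

δ₁-vanishes : ∀ z n → 2 ℕ.≤ n → δ₁ n * z ^ n ≃ 0ℂ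
δ₁-vanishes z (suc (suc n)) _ = ≐⇒≃ (solve 1 (λ p → con 0ℚ :* p := con 0ℚ) ≐-refl (z ^ suc (suc n)))
  where open ℂ-Solver
δ₁-vanishes z 1 (ℕ.s≤s ())

δ₁-sum : ∀ z n → 2 ℕ.≤ n → sum< n (λ k → δ₁ k * z ^ k) ≃ z
δ₁-sum z n 2≤n = ≃-trans (sum<-truncate 2 (δ₁-vanishes z) n 2≤n)
  (≐⇒≃ (solve 1 (λ z → con 0ℚ :+ con 0ℚ :* con 1ℚ :+ con 1ℚ :* (z :* con 1ℚ) := z) ≐-refl z))
  where open ℂ-Solver

δ₁-series : ∀ z → PowerSeries δ₁ z z
δ₁-series z = Sums-cong (λ _ → ≃-refl) (δ₁-sum z 2 ℕ.≤-refl) (Sums-finite 2 (δ₁-vanishes z))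

-- For u = f(t) and v = f(-t), with e and e′ the exponentials of t and -t: the two hypotheses chain
-- to u e e′ = u.
inverse-factors : ∀ {u v e e′} → NonZeroℂ u → u * e ≃ v → v * e′ ≃ u → e * e′ ≃ 1ℂ
inverse-factors {u} {v} {e} {e′} u# ue≃v ve′≃u = *-cancelʳ u u# (begin
  (e * e′) * u ≈⟨ ≐⇒≃ (solve 3 (λ e e′ u → (e :* e′) :* u := (u :* e) :* e′) ≐-refl e e′ u) ⟩
  (u * e) * e′ ≈⟨ *-congˡ e′ ue≃v ⟩
  v * e′       ≈⟨ ve′≃u ⟩
  u            ≈⟨ ≐⇒≃ (solve 1 (λ u → u := con 1ℚ :* u) ≐-refl u) ⟩
  1ℂ * u       ∎)
  where
  open ≃-Reasoning
  open ℂ-Solver using (solve; _:*_; _:=_; con)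

-- For s = q / (e − 1) and s′ = − q / (1/e − 1) = q e / (e − 1).
quotient-difference : ∀ {q s s′ e e′} → NonZeroℂ (e - 1ℂ) → e * e′ ≃ 1ℂ →
  s * (e - 1ℂ) ≃ q → s′ * (e′ - 1ℂ) ≃ - q → s′ - s ≃ q
quotient-difference {q} {s} {s′} {e} {e′} e-1# ee′≃1 hs hs′ = *-cancelʳ (e - 1ℂ) e-1# (begin
  (s′ - s) * (e - 1ℂ)
    ≈⟨ ≐⇒≃ (solve 4 (λ s s′ e e′ → (s′ :- s) :* (e :- con 1ℚ) :=
         s′ :* (e :* e′ :- con 1ℚ) :- e :* (s′ :* (e′ :- con 1ℚ)) :- s :* (e :- con 1ℚ)) ≐-refl s s′ e e′) ⟩
  s′ * (e * e′ - 1ℂ) - e * (s′ * (e′ - 1ℂ)) - s * (e - 1ℂ)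
    ≈⟨ sub-cong (sub-cong (*-congʳ s′ (sub-cong ee′≃1 ≃-refl)) (*-congʳ e hs′)) hs ⟩
  s′ * (1ℂ - 1ℂ) - e * (- q) - q
    ≈⟨ ≐⇒≃ (solve 3 (λ s′ e q → s′ :* (con 1ℚ :- con 1ℚ) :- e :* (:- q) :- q := q :* (e :- con 1ℚ))
         ≐-refl s′ e q) ⟩
  q * (e - 1ℂ) ∎)
  where
  open ≃-Reasoning
  open ℂ-Solver using (solve; _:*_; _:-_; :-_; _:=_; con)

-- The radius is halved to fit the closed interval into the open disk. The point -q comes along for
-- the arguments that compare a function at q and at -q.
Near0⇒Near0⁺ : ∀ {Q : ℂ → Set} → Near0 Q → Near0⁺ (λ q → Q (fromℚ q) × Q (- fromℚ q))
Near0⇒Near0⁺ (ρ , ρ>0 , h) = ρ ℚ.* ½ , half>0 ρ>0 , λ q q>0 q≤ρ/2 →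
  let q∈ = fromℚ∈Disk q>0 (ℚ.≤-<-trans q≤ρ/2 ρ/2<ρ) in h (fromℚ q) q∈ , h (- fromℚ q) (neg∈Disk (fromℚ q) ρ q∈)
  where
  ρ/2<ρ : ρ ℚ.* ½ ℚ.< ρ
  ρ/2<ρ = subst₂ ℚ._<_ (ℚ.+-identityʳ (ρ ℚ.* ½)) (half+half ρ) (ℚ.+-monoʳ-< (ρ ℚ.* ½) (half>0 ρ>0))

Near0-× : ∀ {Q R : ℂ → Set} → Near0 Q → Near0 R → Near0 (λ t → Q t × R t)
Near0-× {Q} {R} (ρ , ρ>0 , h) (σ , σ>0 , k) = choose (min ρ σ ρ>0 σ>0)
  where
  choose : ∃[ τ ] (0ℚ ℚ.< τ × τ ℚ.≤ ρ × τ ℚ.≤ σ) → Near0 (λ t → Q t × R t)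
  choose (τ , τ>0 , τ≤ρ , τ≤σ) = τ , τ>0 , λ t t∈ →
    h t (∈Disk-mono t τ>0 τ≤ρ t∈) , k t (∈Disk-mono t τ>0 τ≤σ t∈)

Near0-map : ∀ {Q R : ℂ → Set} → (∀ t → Q t → R t) → Near0 Q → Near0 R
Near0-map g (ρ , ρ>0 , h) = ρ , ρ>0 , λ t t∈ → g t (h t t∈)

Near0-neg : ∀ {Q : ℂ → Set} → Near0 Q → Near0 (λ t → Q (- t))
Near0-neg (ρ , ρ>0 , h) = ρ , ρ>0 , λ t t∈ → h (- t) (neg∈Disk t ρ t∈)

-- `Near0[ f ]` takes membership in the domain as an assumption; combined with it, this supplies the
-- membership proofs that evaluating f requires.
Near0-domain : (f : HolomorphicAt0) → Near0 (λ t → t ∈Disk HolomorphicAt0.radius f)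
Near0-domain f = radius , radius>0 , λ t t∈ → t∈
  where open HolomorphicAt0 f

-- Continuity of f at 0 and consequences of the symmetry of P

module _ (P : ℕ → Poly) (f : HolomorphicAt0)
  (generates : ∀ x → Near0[ f ] (λ t ft → EGF P x t (ft * exp (x * t)))) where

  open HolomorphicAt0 f

  series-at-0 : Near0[ f ] (λ t ft → PowerSeries (coefficient P 0ℂ) t ft)
  series-at-0 = Near0-map (λ t h t∈ → EGF⇒PowerSeries P 0ℂ t (*-exp-0* (fun t t∈) t) (h t∈)) (generates 0ℂ)

  at0≃coefficient : at0 f ≃ coefficient P 0ℂ 0
  at0≃coefficient = value series-at-0
    where
    value : Near0[ f ] (λ t ft → PowerSeries (coefficient P 0ℂ) t ft) → at0 f ≃ coefficient P 0ℂ 0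
    value (ρ , ρ>0 , h) = PowerSeries-at-0 (coefficient P 0ℂ) (h 0ℂ (0∈Disk ρ>0) (0∈Disk radius>0))

  -- At x = 0 the generating function is f itself, so f is the sum of a power series. One sampled
  -- point of convergence feeds `PowerSeries-continuous`; half of ε is spent on replacing the
  -- constant coefficient by `at0 f`.
  continuous-at-0 : ∀ ε → 0ℚ ℚ.< ε → Near0⁺ (λ q → ∀ q∈ → fun (fromℚ q) q∈ - at0 f ≺ ε)
  continuous-at-0 ε ε>0 = choose (Near0⁺-× (Near0⇒Near0⁺ series-at-0) (Near0⇒Near0⁺ (Near0-domain f)))
    where
    Series : ℚ → Set
    Series q = ∀ q∈ → PowerSeries (coefficient P 0ℂ) (fromℚ q) (fun (fromℚ q) q∈)
    choose : Near0⁺ (λ q → (Series q × _) × (fromℚ q ∈Disk radius × _)) →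
             Near0⁺ (λ q → ∀ q∈ → fun (fromℚ q) q∈ - at0 f ≺ ε)
    choose h = finish (Near0⁺-point h)
      where
      finish : ∃[ q ] (0ℚ ℚ.< q × ((Series q × _) × (fromℚ q ∈Disk radius × _))) →
               Near0⁺ (λ q → ∀ q∈ → fun (fromℚ q) q∈ - at0 f ≺ ε)
      finish (ρ , ρ>0 , (hρ , _) , ρ∈ , _) = Near0⁺-map
        (λ q _ (k , hq , _) q∈ → subst (fun (fromℚ q) q∈ - at0 f ≺_) (half+half ε)
          (≺-resp-≃ (sub-cong ≃-refl (≃-sym at0≃coefficient)) (half>0 ε>0) (k (fun (fromℚ q) q∈) (hq q∈))))
        (Near0⁺-× (PowerSeries-continuous ρ>0 (hρ ρ∈) (ε ℚ.* ½) (half>0 ε>0)) (Near0⇒Near0⁺ series-at-0))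

  module _ (reflected : ∀ n x → eval (P n) (1ℂ - x) ≈ (- 1ℂ) ^ n * eval (P n) x) where

    functional-equation : Near0 (λ t → ∀ t∈ -t∈ → fun t t∈ * exp t ≃ fun (- t) -t∈)
    functional-equation = Near0-map
      (λ t (h₁ , h₀) t∈ -t∈ → Sums-unique
        (Sums-cong (λ n → term t n) (*-congʳ (fun t t∈) (exp-1* t)) (HasSum⇒Sums (h₁ t∈)))
        (EGF-neg⇒PowerSeries P 0ℂ t (*-exp-0* (fun (- t) -t∈) (- t)) (h₀ -t∈)))
      -- The point 1 is taken in the form `1ℂ - 0ℂ` in which `reflected` at 0 delivers it, so that
      -- the polynomials are evaluated at literally the same argument.
      (Near0-× (generates (1ℂ - 0ℂ)) (Near0-neg (generates 0ℂ)))
      where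
      term : ∀ t n → eval (P n) (1ℂ - 0ℂ) * (t ^ n * 1/! n) ≃ ((- 1ℂ) ^ n * coefficient P 0ℂ n) * t ^ n
      term t n = ≃-trans (*-congˡ (t ^ n * 1/! n) (≈⇒≃ (reflected n 0ℂ)))
        (≐⇒≃ (solve 4 (λ m p t c → (m :* p) :* (t :* c) := (m :* (p :* c)) :* t) ≐-refl
          ((- 1ℂ) ^ n) (eval (P n) 0ℂ) (t ^ n) (1/! n)))
        where open ℂ-Solver

    -- Cancelling f(q) requires it to be apart from 0, which continuity transfers from f(0).
    exp-inverse : at0 f # 0ℂ → Near0⁺ (λ q → exp (fromℚ q) * exp (- fromℚ q) ≃ 1ℂ)
    exp-inverse f0# = choose (NonZero-near (#⇒NonZero f0#))
      where
      Equation : ℂ → Set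
      Equation t = ∀ t∈ -t∈ → fun t t∈ * exp t ≃ fun (- t) -t∈
      choose : ∃[ δ ] (0ℚ ℚ.< δ × (∀ w → w - at0 f ≺ δ → NonZeroℂ w)) →
               Near0⁺ (λ q → exp (fromℚ q) * exp (- fromℚ q) ≃ 1ℂ)
      choose (δ , δ>0 , near) = Near0⁺-map (λ q _ → inverse q)
        (Near0⁺-× (continuous-at-0 δ δ>0)
          (Near0⁺-× (Near0⇒Near0⁺ (Near0-domain f))
            (Near0⇒Near0⁺ (Near0-× functional-equation (Near0-neg functional-equation)))))
        where
        inverse : ∀ q → (∀ q∈ → fun (fromℚ q) q∈ - at0 f ≺ δ) ×
                  ((fromℚ q ∈Disk radius × (- fromℚ q) ∈Disk radius) ×
                   ((Equation (fromℚ q) × Equation (- fromℚ q)) × _)) →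
                  exp (fromℚ q) * exp (- fromℚ q) ≃ 1ℂ
        inverse q (close-q , (q∈ , -q∈) , ((e , e′) , _)) =
          inverse-factors (near (fun (fromℚ q) q∈) (close-q q∈)) (e q∈ -q∈)
            -- The equation at -q ends in f(-(-q)), with its own membership proof; `fun-cong` leads
            -- back to f(q).
            (≃-trans (e′ -q∈ q∈′) (≈⇒≃ (fun-cong q∈′ q∈ (≃⇒≈ (≐⇒≃ neg-neg)))))
          where
          neg-neg : - - fromℚ q ≐ fromℚ q
          neg-neg = solve 1 (λ q → :- :- q := q) ≐-refl (fromℚ q)
            where open ℂ-Solver
          q∈′ : (- - fromℚ q) ∈Disk radius
          q∈′ = neg∈Disk (- fromℚ q) radius -q∈

-- Odd part of the Bernoulli generating function

module _ (B : ℕ → Poly) (isBernoulli : IsBernoulli B) where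

  -- One equation covers all parities: for n = 1 it reads -2 B₁(0) = 1, for other odd n it reads -2
  -- Bₙ(0)/n! = 0, and for even n it is trivial. It compares the coefficients of b(-t) - b(t) with
  -- those of t.
  bernoulli-odd-part : Near0⁺ (λ q → exp (fromℚ q) * exp (- fromℚ q) ≃ 1ℂ) →
    ∀ n → (- 1ℂ) ^ n * coefficient B 0ℂ n - coefficient B 0ℂ n ≃ δ₁ n
  bernoulli-odd-part inverse = PowerSeries-unique {λ n → (- 1ℂ) ^ n * c n - c n} {δ₁} (Near0⁺-map odd
    (Near0⁺-× inverse (Near0⇒Near0⁺ (isBernoulli 0ℂ))))
    where
    Generated : ℂ → Set
    Generated t = t # 0ℂ →
      ∃[ s ] (EGF B 0ℂ t s × IsQuotient (t * exp (0ℂ * t)) (exp t - 1ℂ) s)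
    c : ℕ → ℂ
    c = coefficient B 0ℂ
    odd : ∀ q → 0ℚ ℚ.< q → exp (fromℚ q) * exp (- fromℚ q) ≃ 1ℂ ×
          (Generated (fromℚ q) × Generated (- fromℚ q)) →
          ∃[ s ] (PowerSeries (λ n → (- 1ℂ) ^ n * c n - c n) (fromℚ q) s × PowerSeries δ₁ (fromℚ q) s)
    odd q q>0 (inv , g , g′) = combine (g (NonZero⇒# q#)) (g′ (NonZero⇒# (NonZero-neg q#)))
      where
      t : ℂ
      t = fromℚ q
      q# : NonZeroℂ t
      q# = NonZero-fromℚ q>0
      combine : ∃[ s ] (EGF B 0ℂ t s × IsQuotient (t * exp (0ℂ * t)) (exp t - 1ℂ) s) →
                ∃[ s ] (EGF B 0ℂ (- t) s × IsQuotient (- t * exp (0ℂ * - t)) (exp (- t) - 1ℂ) s) →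
                ∃[ s ] (PowerSeries (λ n → (- 1ℂ) ^ n * c n - c n) t s × PowerSeries δ₁ t s)
      combine (s , egf , e-1# , quot) (s′ , egf′ , _ , quot′) = t ,
        Sums-cong
          (λ n → ≐⇒≃ (solve 3 (λ x y p → x :* p :- y :* p := (x :- y) :* p) ≐-refl
            ((- 1ℂ) ^ n * c n) (c n) (t ^ n)))
          (quotient-difference (#⇒NonZero e-1#) inv
            (≃-trans (≈⇒≃ {s * (exp t - 1ℂ)} {t * exp (0ℂ * t)} quot) (*-exp-0* t t))
            (≃-trans (≈⇒≃ {s′ * (exp (- t) - 1ℂ)} {(- t) * exp (0ℂ * - t)} quot′) (*-exp-0* (- t) (- t))))
          (Sums-sub (EGF-neg⇒PowerSeries B 0ℂ t ≃-refl egf′) (EGF⇒PowerSeries B 0ℂ t ≃-refl egf)) ,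
        δ₁-series t
        where open ℂ-Solver

bernoulliSum-odd : ∀ B N t → 1 ℕ.≤ N →
  (∀ n → (- 1ℂ) ^ n * coefficient B 0ℂ n - coefficient B 0ℂ n ≃ δ₁ n) →
  bernoulliSum B N (- t) - bernoulliSum B N t ≃ t
bernoulliSum-odd B N t 1≤N odd = begin
  bernoulliSum B N (- t) - bernoulliSum B N t
    ≈⟨ ≐⇒≃ (≐-sym (sum<-sub (suc N) (λ k → eval (B k) 0ℂ * ((- t) ^ k * 1/! k))
         (λ k → eval (B k) 0ℂ * (t ^ k * 1/! k)))) ⟩
  sum< (suc N) (λ k → eval (B k) 0ℂ * ((- t) ^ k * 1/! k) - eval (B k) 0ℂ * (t ^ k * 1/! k))
    ≈⟨ sum<-cong (suc N) term ⟩
  sum< (suc N) (λ k → δ₁ k * t ^ k)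
    -- The sum has N + 1 terms, so N ≥ 1 ensures that index 1, the only nonzero term, is among them.
    ≈⟨ δ₁-sum t (suc N) (ℕ.s≤s 1≤N) ⟩
  t ∎
  where
  open ≃-Reasoning
  open ℂ-Solver using (solve; _:*_; _:-_; _:=_)
  term : ∀ k → eval (B k) 0ℂ * ((- t) ^ k * 1/! k) - eval (B k) 0ℂ * (t ^ k * 1/! k) ≃ δ₁ k * t ^ k
  term k = ≃-trans
    (≐⇒≃ (≐-trans
      (+-cong≐ (*-cong≐ (≐-refl {eval (B k) 0ℂ}) (*-cong≐ (neg-^ t k) (≐-refl {1/! k}))) ≐-refl)
      (solve 4 (λ b m t c → b :* ((m :* t) :* c) :- b :* (t :* c) := (m :* (b :* c) :- b :* c) :* t) ≐-refl
        (eval (B k) 0ℂ) ((- 1ℂ) ^ k) (t ^ k) (1/! k))))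
    (*-congˡ (t ^ k) (odd k))

-- The expansion (e^q - 1)/q = ∑ qⁿ/(n + 1)!, with y = 1/q; its constant term 1 is the limit at 0.
exp-quotient-series : ∀ q (q>0 : 0ℚ ℚ.< q) → ∃[ y ] (y ℚ.* q ≡ 1ℚ ×
  PowerSeries (1/! ∘ suc) (fromℚ q) (fromℚ y * (exp (fromℚ q) - 1ℂ)))
exp-quotient-series q q>0 with divide 1ℚ q (ℚ.positive⁻¹ 1ℚ) q>0
... | y , _ , yq≡1 = y , yq≡1 ,
  PowerSeries-tail {1/!} (fromℚ q) (fromℚ y) (fromℚ-inverse y q yq≡1) (exp-rational q)

-- Identification of f and of P

module _ (f : HolomorphicAt0) where

  open HolomorphicAt0 f

  -- The conclusion is a product instead of a quotient, so it holds at every t near 0, whether or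
  -- not t is known to be apart from 0.
  solves : (S : ℂ → ℂ) → (∀ t → S (- t) - S t ≃ t) →
    Near0 (λ t → ∀ t∈ -t∈ → fun t t∈ * exp t ≃ fun (- t) -t∈) →
    EvenNear0 radius (λ t t∈ → fun t t∈ - S t) →
    Near0[ f ] (λ t ft → ft * (exp t - 1ℂ) ≃ t)
  solves S S-odd equation even = Near0-map
    (λ t (equation-t , even-t , -t∈) t∈ → solution t (fun t t∈) (fun (- t) -t∈)
      (equation-t t∈ -t∈) (≈⇒≃ (even-t t∈ -t∈)))
    (Near0-× equation (Near0-× even (Near0-neg (Near0-domain f))))
    where
    open ≃-Reasoning
    open ℂ-Solver using (solve; _:*_; _:+_; _:-_; _:=_; con)
    solution : ∀ t u v → u * exp t ≃ v → v - S (- t) ≃ u - S t → u * (exp t - 1ℂ) ≃ t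
    solution t u v e e′ = begin
      u * (exp t - 1ℂ)
        ≈⟨ ≐⇒≃ (solve 2 (λ u x → u :* (x :- con 1ℚ) := u :* x :- u) ≐-refl u (exp t)) ⟩
      u * exp t - u
        ≈⟨ sub-cong e ≃-refl ⟩
      v - u
        ≈⟨ ≐⇒≃ (solve 4 (λ u v a b → v :- u := (v :- a) :- (u :- b) :+ (a :- b)) ≐-refl
             u v (S (- t)) (S t)) ⟩
      (v - S (- t)) - (u - S t) + (S (- t) - S t)
        ≈⟨ +-cong (sub-cong e′ ≃-refl) (S-odd t) ⟩
      (u - S t) - (u - S t) + t
        ≈⟨ ≐⇒≃ (solve 2 (λ x t → x :- x :+ t := t) ≐-refl (u - S t) t) ⟩
      t ∎

  module _ (solved : Near0[ f ] (λ t ft → ft * (exp t - 1ℂ) ≃ t)) where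

    -- The denominator is apart from 0 because its multiple f(t) (eᵗ - 1), being t, is.
    isQuotient : Near0[ f ] (λ t ft → t # 0ℂ → IsQuotient t (exp t - 1ℂ) ft)
    isQuotient = Near0-map (λ t h t∈ t# →
      NonZero⇒# (NonZero-*ʳ (fun t t∈) (exp t - 1ℂ) (NonZero-resp-≃ (≃-sym (h t∈)) (#⇒NonZero t#))) ,
      ≃⇒≈ (h t∈)) solved

    -- For small q > 0 the factors f(q) and (e^q - 1)/q have product 1 and are close to f(0) and 1,
    -- so `limit-product` gives f(0) · 1 = 1.
    at0≃1 : (∀ ε → 0ℚ ℚ.< ε → Near0⁺ (λ q → ∀ q∈ → fun (fromℚ q) q∈ - at0 f ≺ ε)) → at0 f ≃ 1ℂ
    at0≃1 continuous = ≃-trans (≐⇒≃ (solve 1 (λ z → z := z :* con 1ℚ) ≐-refl (at0 f)))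
      (limit-product {at0 f} {1ℂ} {1ℂ} approximation)
      where
      open ℂ-Solver
      approximation : ∀ ε → 0ℚ ℚ.< ε → ∃[ z ] ∃[ w ] (z - at0 f ≺ ε × w - 1ℂ ≺ ε × z * w ≃ 1ℂ)
      -- The value 1 serves as the point of convergence that `PowerSeries-continuous` starts from;
      -- any positive rational would do.
      approximation ε ε>0 = choose (exp-quotient-series 1ℚ (ℚ.positive⁻¹ 1ℚ))
        where
        Close : ℚ → Set
        Close q = ∀ s → PowerSeries (1/! ∘ suc) (fromℚ q) s → s - 1ℂ ≺ ε
        point : ∀ q → 0ℚ ℚ.< q → (∀ q∈ → fun (fromℚ q) q∈ - at0 f ≺ ε) → Close q →
                (q∈ : fromℚ q ∈Disk radius) → fun (fromℚ q) q∈ * (exp (fromℚ q) - 1ℂ) ≃ fromℚ q →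
                ∃[ z ] ∃[ w ] (z - at0 f ≺ ε × w - 1ℂ ≺ ε × z * w ≃ 1ℂ)
        point q q>0 hf hexp q∈ e = quotient (exp-quotient-series q q>0)
          where
          u x : ℂ
          u = fun (fromℚ q) q∈
          x = exp (fromℚ q) - 1ℂ
          quotient : ∃[ y ] (y ℚ.* q ≡ 1ℚ × PowerSeries (1/! ∘ suc) (fromℚ q) (fromℚ y * x)) →
                     ∃[ z ] ∃[ w ] (z - at0 f ≺ ε × w - 1ℂ ≺ ε × z * w ≃ 1ℂ)
          quotient (y , yq≡1 , series) = u , fromℚ y * x , hf q∈ , hexp (fromℚ y * x) series ,
            ≃-trans (≐⇒≃ (solve 3 (λ u y x → u :* (y :* x) := y :* (u :* x)) ≐-refl u (fromℚ y) x))
              (≃-trans (*-congʳ (fromℚ y) e) (≐⇒≃ (fromℚ-inverse y q yq≡1)))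
        choose : ∃[ y ] (y ℚ.* 1ℚ ≡ 1ℚ × PowerSeries (1/! ∘ suc) (fromℚ 1ℚ) (fromℚ y * (exp (fromℚ 1ℚ) - 1ℂ))) →
                 ∃[ z ] ∃[ w ] (z - at0 f ≺ ε × w - 1ℂ ≺ ε × z * w ≃ 1ℂ)
        choose (_ , _ , series) = finish (Near0⁺-point (Near0⁺-× (continuous ε ε>0)
          (Near0⁺-× (PowerSeries-continuous {1/! ∘ suc} (ℚ.positive⁻¹ 1ℚ) series ε ε>0)
            (Near0⇒Near0⁺ (Near0-× (Near0-domain f) solved)))))
          where
          finish : ∃[ q ] (0ℚ ℚ.< q × ((∀ q∈ → fun (fromℚ q) q∈ - at0 f ≺ ε) × (Close q ×
                     ((fromℚ q ∈Disk radius × (∀ t∈ → fun (fromℚ q) t∈ * (exp (fromℚ q) - 1ℂ) ≃ fromℚ q)) × _)))) →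
                   ∃[ z ] ∃[ w ] (z - at0 f ≺ ε × w - 1ℂ ≺ ε × z * w ≃ 1ℂ)
          finish (q , q>0 , hf , hexp , (q∈ , e) , _) = point q q>0 hf hexp q∈ (e q∈)

    -- For fixed x the two generating functions agree at small rational t > 0: multiplied by eᵗ - 1,
    -- which is apart from 0 there, both become t e^{xt}. The identity theorem in t then compares
    -- the coefficients.
    bernoulli-unique : ∀ P → (∀ x → Near0[ f ] (λ t ft → EGF P x t (ft * exp (x * t)))) →
      ∀ B → IsBernoulli B → ∀ n x → eval (P n) x ≃ eval (B n) x
    bernoulli-unique P generates B isBernoulli n x = coefficient-injective P B x
      (PowerSeries-unique {coefficient P x} {coefficient B x} (Near0⁺-map common
        (Near0⇒Near0⁺ (Near0-× (Near0-domain f)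
          (Near0-× solved (Near0-× (generates x) (isBernoulli x))))))) n
      where
      At : ℂ → Set
      At t = t ∈Disk radius × ((∀ t∈ → fun t t∈ * (exp t - 1ℂ) ≃ t) ×
        ((∀ t∈ → EGF P x t (fun t t∈ * exp (x * t))) ×
         (t # 0ℂ → ∃[ s ] (EGF B x t s × IsQuotient (t * exp (x * t)) (exp t - 1ℂ) s))))
      common : ∀ q → 0ℚ ℚ.< q → At (fromℚ q) × At (- fromℚ q) →
               ∃[ s ] (PowerSeries (coefficient P x) (fromℚ q) s × PowerSeries (coefficient B x) (fromℚ q) s)
      common q q>0 ((q∈ , e , hP , hB) , _) = compare (hB (NonZero⇒# (NonZero-fromℚ q>0)))
        where
        t u : ℂ
        t = fromℚ q
        u = fun t q∈
        compare : ∃[ s ] (EGF B x t s × IsQuotient (t * exp (x * t)) (exp t - 1ℂ) s) →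
                  ∃[ s ] (PowerSeries (coefficient P x) t s × PowerSeries (coefficient B x) t s)
        compare (s , egf , e-1# , quot) = s , EGF⇒PowerSeries P x t agree (hP q∈) ,
          EGF⇒PowerSeries B x t ≃-refl egf
          where
          open ≃-Reasoning
          open ℂ-Solver using (solve; _:*_; _:=_)
          agree : u * exp (x * t) ≃ s
          agree = *-cancelʳ (exp t - 1ℂ) (#⇒NonZero e-1#) (begin
            (u * exp (x * t)) * (exp t - 1ℂ)
              ≈⟨ ≐⇒≃ (solve 3 (λ u a b → (u :* a) :* b := (u :* b) :* a) ≐-refl u (exp (x * t)) (exp t - 1ℂ)) ⟩
            (u * (exp t - 1ℂ)) * exp (x * t)
              ≈⟨ *-congˡ (exp (x * t)) (e q∈) ⟩
            t * exp (x * t)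
              ≈⟨ ≃-sym (≈⇒≃ {s * (exp t - 1ℂ)} quot) ⟩
            s * (exp t - 1ℂ) ∎)

mainTheorem5 : (B : ℕ → Poly) → IsBernoulli B →
    (P : ℕ → Poly) (f : HolomorphicAt0) → at0 f # 0ℂ →
    (∀ x → Near0[ f ] (λ t ft → EGF P x t (ft * exp (x * t)))) →
    (∀ n x → eval (P n) (1ℂ - x) ≈ (- 1ℂ) ^ n * eval (P n) x) →
    (N : ℕ) → .{{_ : NonZero N}} →
    EvenNear0 (HolomorphicAt0.radius f)
    (λ t t∈ → HolomorphicAt0.fun f t t∈ - bernoulliSum B N t) →
    (∀ n x → eval (P n) x ≈ eval (B n) x)
    × (at0 f ≈ 1ℂ)
    × Near0[ f ] (λ t ft → t # 0ℂ → IsQuotient t (exp t - 1ℂ) ft)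
mainTheorem5 B isBernoulli P f f0# generates reflected N even =
  (λ n x → ≃⇒≈ (bernoulli-unique f solved P generates B isBernoulli n x)) ,
  ≃⇒≈ (at0≃1 f solved (continuous-at-0 P f generates)) ,
  isQuotient f solved
  where
  odd : ∀ t → bernoulliSum B N (- t) - bernoulliSum B N t ≃ t
  odd t = bernoulliSum-odd B N t (ℕ.>-nonZero⁻¹ N)
    (bernoulli-odd-part B isBernoulli (exp-inverse P f generates reflected f0#))
  solved : Near0[ f ] (λ t ft → ft * (exp t - 1ℂ) ≃ t)
  solved = solves f (bernoulliSum B N) odd (functional-equation P f generates reflected) even
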